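{- Let $\alpha=(\alpha_i)_{i\ge1}$, $\beta=(\beta_i)_{i\ge1}$ be sequences of non-negative reals with convergent sums, let $\gamma\ge0$ be real, let $x=(x_1,x_2,\dots)$ be variables, and let $n\ge1$. Then $$\sum_{\lambda:\ \ell(\lambda)\le n}S_\lambda(\alpha,\beta,\gamma)\,s_\lambda(x)=D_n\left(e^{\gamma z}\prod_{r=1}^\infty\frac{1+\beta_rz}{(1-x_r/z)(1-\alpha_rz)}\right),$$ where the sum is over all partitions $\lambda$ with at most $n$ parts.
   Context: **Toeplitz determinants.** For $f(z)=\sum_{k=-\infty}^\infty c_kz^k$, $D_n(f)$ denotes the determinant of the $n\times n$ matrix whose $(i,j)$ entry is $c_{j-i}$, $1\le i,j\le n$. In the claim, the identity is read as one of formal power series in the variables $x_r$, and $c_k$ is the coefficient of $z^k$ obtained by expanding $\prod_r(1-x_r/z)^{ -1}$ in powers of $1/z$ and the remaining factors in powers of $z$. **Extended Schur functions.** The extended complete symmetric functions $\tilde h_k(\alpha,\beta,\gamma)$ are defined by $$\sum_{k\ge0}\tilde h_k(\alpha,\beta,\gamma)z^k=e^{\gamma z}\prod_{i\ge1}\frac{1+\beta_iz}{1-\alpha_iz},$$ with $\tilde h_k=0$ for $k<0$. For a partition $\lambda=(\lambda_1,\dots,\lambda_m)$, $S_\lambda(\alpha,\beta,\gamma)=\det(\tilde h_{\lambda_i-i+j})_{i,j=1}^m$. $s_\lambda(x)$ is the usual Schur function and $\ell(\lambda)$ is the number of (nonzero) parts of $\lambda$. -}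

module Defs where

open import Algebra.Bundles using (CommutativeRing; RawRing)
import Algebra.Definitions.RawSemiring as RawSemiringDefinitions
import Algebra.Properties.Semiring.Sum as SemiringSum
import Algebra.Solver.Ring.NaturalCoefficients.Default as RingSolver
open import Data.Fin.Base as Fin using (Fin; punchIn; toℕ)
open import Data.Integer.Base as ℤ using (ℤ; +_; -[1+_])
open import Data.List.Base as List using (List; []; _∷_; _∷ʳ_; length; lookup)
import Data.List.Properties as List
open import Data.List.Relation.Binary.Subset.Propositional using (_⊆_)
open import Data.List.Relation.Unary.All using (All)
open import Data.List.Relation.Unary.Linked using (Linked)
open import Data.List.Relation.Unary.Unique.Propositional using (Unique)
open import Data.Nat.Base as ℕ using (ℕ; zero; suc; _!)
import Data.Nat.ListAction as ListAction
import Data.Nat.Properties as ℕ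
open import Data.Product.Base using (∃; ∃-syntax; _×_; _,_; proj₁; proj₂)
open import Data.Sum.Base using (_⊎_; inj₁; inj₂)
open import Level using (Level; _⊔_) renaming (suc to lsuc)
open import Relation.Binary.Core using (Rel)
open import Relation.Binary.Definitions using (Cotransitive)
open import Relation.Binary.Structures using (IsPreorder; IsStrictPartialOrder)
import Relation.Binary.Reasoning.Base.Triple as Triple
open import Relation.Nullary.Negation.Core using (¬_; contradiction)

private variable
  r₁ r₂ : Level

-- The real numbers, axiomatised as a Cauchy complete Archimedean ordered
-- field.  The axioms are in constructive form (the order is cotransitive
-- and tight rather than trichotomous), so they hold of the classical reals
-- and of the Cauchy reals alike.

record Reals c ℓ₁ ℓ₂ : Set (lsuc (c ⊔ ℓ₁ ⊔ ℓ₂)) where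
  field
    commutativeRing : CommutativeRing c ℓ₁

  open CommutativeRing commutativeRing public
  open RawSemiringDefinitions (RawRing.rawSemiring rawRing) public
    using (_^_) renaming (_×_ to _×ℕ_)

  infix 4 _<_ _≤_ _⟶_

  field
    _<_                  : Rel Carrier ℓ₂
    isStrictPartialOrder : IsStrictPartialOrder _≈_ _<_
    <-cotrans            : Cotransitive _<_
    <-tight              : ∀ {x y} → ¬ x < y → ¬ y < x → x ≈ y
    +-monoˡ-<            : ∀ z {x y} → x < y → x + z < y + z
    *-pos                : ∀ {x y} → 0# < x → 0# < y → 0# < x * y
    0<1                  : 0# < 1#
    inverse              : ∀ {x} → 0# < x → ∃[ y ] 0# < y × x * y ≈ 1#
    archimedean          : ∀ x → ∃[ n ] x < n ×ℕ 1#

  _≤_ : Rel Carrier ℓ₂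
  x ≤ y = ¬ y < x

  _⟶_ : (ℕ → Carrier) → Carrier → Set (c ⊔ ℓ₂)
  f ⟶ l = ∀ {ε} → 0# < ε →
    ∃[ N ] (∀ n → N ℕ.≤ n → f n < l + ε × l < f n + ε)

  -- One inequality suffices, since m and n may be exchanged.
  Cauchy : (ℕ → Carrier) → Set (c ⊔ ℓ₂)
  Cauchy f = ∀ {ε} → 0# < ε →
    ∃[ N ] (∀ m n → N ℕ.≤ m → N ℕ.≤ n → f m < f n + ε)

  field
    complete : ∀ {f} → Cauchy f → ∃[ l ] f ⟶ l

  partialSum : (ℕ → Carrier) → ℕ → Carrier
  partialSum a zero    = 0#
  partialSum a (suc n) = partialSum a n + a n

  Summable : (ℕ → Carrier) → Set (c ⊔ ℓ₂)
  Summable a = ∃[ s ] partialSum a ⟶ s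

module OverRing (A : RawRing r₁ r₂) where
  open RawRing A
  open RawSemiringDefinitions rawSemiring using (_^_; sum)

  Series : Set r₁
  Series = ℕ → Carrier

  infixl 7 _⊛_
  _⊛_ : Series → Series → Series
  (f ⊛ g) k = sum {suc k} λ i → f (toℕ i) * g (k ℕ.∸ toℕ i)

  1+_z : Carrier → Series
  (1+ a z) 0             = 1#
  (1+ a z) 1             = a
  (1+ a z) (suc (suc k)) = 0#

  1/[1-_z] : Carrier → Series
  1/[1- a z] k = a ^ k

  1ₛ : Series
  1ₛ zero    = 1#
  1ₛ (suc _) = 0#

  ∏[_] : ℕ → (ℕ → Series) → Series
  ∏[ zero  ] f = 1ₛ
  ∏[ suc N ] f = f N ⊛ ∏[ N ] f

  atℤ : Series → ℤ → Carrier
  atℤ f (+ k)    = f k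
  atℤ f -[1+ _ ] = 0#

  Matrix : ℕ → Set r₁
  Matrix n = Fin n → Fin n → Carrier

  -- Laplace expansion along the first row.
  det : ∀ {n} → Matrix n → Carrier
  det {zero}  M = 1#
  det {suc n} M = sum λ j →
    (- 1#) ^ toℕ j * M Fin.zero j * det (λ i k → M (Fin.suc i) (punchIn j k))

  toeplitz : ∀ n → (ℤ → Carrier) → Matrix n
  toeplitz n a i j = a (+ toℕ j ℤ.- + toℕ i)

  D : ℕ → (ℤ → Carrier) → Carrier
  D n a = det (toeplitz n a)

record Partition : Set where
  field
    parts      : List ℕ
    decreasing : Linked ℕ._≥_ parts
    positive   : All (ℕ._> 0) parts

open Partition public using (parts)

ℓ : Partition → ℕ
ℓ λ′ = length (parts λ′)

-- The shapes met below may have zeros at the end.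
Shape : Set
Shape = List ℕ

size : Shape → ℕ
size = ListAction.sum

firstPart : Shape → ℕ
firstPart []      = 0
firstPart (a ∷ _) = a

-- All ν with λ₁ ≥ ν₁ ≥ λ₂ ≥ ν₂ ≥ …, i.e. such that λ/ν is a horizontal
-- strip.
removeStrip : Shape → List Shape
removeStrip []      = [] ∷ []
removeStrip (a ∷ λ′) = List.cartesianProductWith _∷_
  (List.filter (firstPart λ′ ℕ.≤?_) (List.upTo (suc a)))
  (removeStrip λ′)

-- The semistandard tableaux of a given shape λ with entries in {1,…,N},
-- as chains ∅ = λ⁽⁰⁾ ⊆ λ⁽¹⁾ ⊆ … ⊆ λ⁽ᴺ⁾ = λ in which every step is a
-- horizontal strip: λ⁽ⁱ⁾ is the shape formed by the entries ≤ i.  A tableau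
-- is listed as λ⁽¹⁾,…,λ⁽ᴺ⁾.
tableaux : ℕ → Shape → List (List Shape)
tableaux zero    λ′ with size λ′
... | zero  = [] ∷ []
... | suc _ = []
tableaux (suc N) λ′ =
  List.concatMap (λ ν → List.map (_∷ʳ λ′) (tableaux N ν)) (removeStrip λ′)

-- The number of entries equal to 1, 2, …, N.
content : List Shape → List ℕ
content = go 0
  where
  go : ℕ → List Shape → List ℕ
  go _ []      = []
  go m (σ ∷ T) = (size σ ℕ.∸ m) ∷ go (size σ) T

kostka : Partition → List ℕ → ℕ
kostka λ′ μ = length
  (List.filter (λ T → List.≡-dec ℕ._≟_ (content T) μ)
               (tableaux (length μ) (parts λ′)))

-- Formal power series in the variables x₁, x₂, …  (numbered from 0 below).
-- The list μ₁,…,μ_N stands for the monomial x₁^μ₁⋯x_N^μ_N.  Lists that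
-- differ by zeros at the end stand for the same monomial, and all the
-- series built below take equal values on them.  Restricting a series to
-- the lists of length N amounts to setting x_r = 0 for r > N.

module PowerSeries (K : CommutativeRing r₁ r₂) where
  private module K = CommutativeRing K
  open K using (Carrier)
  open RawSemiringDefinitions (RawRing.rawSemiring K.rawRing)
    using (sum) renaming (_×_ to _×ℕ_)

  FPS : Set r₁
  FPS = List ℕ → Carrier

  infix 4 _≈_
  _≈_ : Rel FPS r₂
  f ≈ g = ∀ μ → f μ K.≈ g μ

  0ₚ : FPS
  0ₚ _ = K.0#

  infixl 6 _+_
  _+_ : FPS → FPS → FPS
  (f + g) μ = f μ K.+ g μ

  -_ : FPS → FPS
  (- f) μ = K.- f μ

  infixr 7 _•_
  _•_ : Carrier → FPS → FPS
  (a • f) μ = a K.* f μ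

  1ₚ : FPS
  1ₚ []          = K.1#
  1ₚ (zero  ∷ μ) = 1ₚ μ
  1ₚ (suc _ ∷ μ) = K.0#

  x : ℕ → FPS
  x _       []          = K.0#
  x zero    (1 ∷ μ)     = 1ₚ μ
  x zero    (_ ∷ μ)     = K.0#
  x (suc r) (zero  ∷ μ) = x r μ
  x (suc r) (suc _ ∷ μ) = K.0#

  -- The coefficient of x^μ is the sum of f ν * g ρ over all pairs of
  -- exponent vectors with ν + ρ = μ.
  infixl 7 _*_
  _*_ : FPS → FPS → FPS
  (f * g) []      = f [] K.* g []
  (f * g) (a ∷ μ) = sum {suc a} λ i →
    ((λ ν → f (toℕ i ∷ ν)) * (λ ρ → g ((a ℕ.∸ toℕ i) ∷ ρ))) μ

  rawRing : RawRing r₁ r₂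
  rawRing = record
    { Carrier = FPS
    ; _≈_ = _≈_
    ; _+_ = _+_
    ; _*_ = _*_
    ; -_  = -_
    ; 0#  = 0ₚ
    ; 1#  = 1ₚ
    }

  open OverRing rawRing public

  sumₗ : ∀ {i} {I : Set i} → (I → FPS) → List I → FPS
  sumₗ f = List.foldr (λ i s → f i + s) 0ₚ

  -- Summability of families of formal power series: every coefficient of
  -- the finite partial sums is eventually constant.
  HasSum : ∀ {i} {I : Set i} → (I → FPS) → FPS → Set (i ⊔ r₂)
  HasSum {I = I} f s = ∀ μ → ∃[ F ] (∀ (G : List I) → Unique G → F ⊆ G →
    sumₗ f G μ K.≈ s μ)

  -- The infinite sum of series f m such that all terms of f m have degree ≥ m:
  -- only those with m ≤ |μ| contribute to the coefficient of x^μ.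
  ∑∞ : (ℕ → FPS) → FPS
  ∑∞ f μ = sum {suc (size μ)} λ m → f (toℕ m) μ

  -- ∏_{r≥1} (1 - x_r w)⁻¹ as a series in w: the factors with r > N do not
  -- contribute to the coefficients of monomials in x₁,…,x_N.
  ∏1/[1-xw] : Series
  ∏1/[1-xw] m μ = ∏[ length μ ] (λ r → 1/[1- x r z]) m μ

  schur : Partition → FPS
  schur λ′ μ = kostka λ′ μ ×ℕ K.1#

module OrderProperties {c ℓ₁ ℓ₂} (R : Reals c ℓ₁ ℓ₂) where
  open Reals R
  open IsStrictPartialOrder isStrictPartialOrder public
    using (<-resp-≈; <-respˡ-≈; <-respʳ-≈; irrefl; asym)
    renaming (trans to <-trans)
  open RingSolver commutativeSemiring
    using (solve; _:=_; _:+_; _:*_)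

  ≤-reflexive : ∀ {x y} → x ≈ y → x ≤ y
  ≤-reflexive x≈y y<x = irrefl (sym x≈y) y<x

  ≤-trans : ∀ {x y z} → x ≤ y → y ≤ z → x ≤ z
  ≤-trans {y = y} x≤y y≤z z<x with <-cotrans z<x y
  ... | inj₁ z<y = y≤z z<y
  ... | inj₂ y<x = x≤y y<x

  <⇒≤ : ∀ {x y} → x < y → x ≤ y
  <⇒≤ = asym

  <-≤-trans : ∀ {x y z} → x < y → y ≤ z → x < z
  <-≤-trans {z = z} x<y y≤z with <-cotrans x<y z
  ... | inj₁ x<z = x<z
  ... | inj₂ z<y = contradiction z<y y≤z

  ≤-<-trans : ∀ {x y z} → x ≤ y → y < z → x < z
  ≤-<-trans {x} x≤y y<z with <-cotrans y<z x
  ... | inj₁ y<x = contradiction y<x x≤y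
  ... | inj₂ x<z = x<z

  ≤-isPreorder : IsPreorder _≈_ _≤_
  ≤-isPreorder = record
    { isEquivalence = isEquivalence
    ; reflexive     = ≤-reflexive
    ; trans         = ≤-trans
    }

  open Triple ≤-isPreorder asym <-trans <-resp-≈ <⇒≤ <-≤-trans ≤-<-trans
    public using (begin_; begin-strict_; begin-equality_; step-<; step-≤; step-≈; step-≈-⟩; step-≈-⟨; _∎)

  +-cancelʳ-< : ∀ z {x y} → x + z < y + z → x < y
  +-cancelʳ-< z x+z<y+z =
    <-respˡ-≈ (lemma _) (<-respʳ-≈ (lemma _) (+-monoˡ-< (- z) x+z<y+z))
    where
    lemma : ∀ w → w + z + - z ≈ w
    lemma w = trans (+-assoc w z (- z))
                    (trans (+-congˡ (-‿inverseʳ z)) (+-identityʳ w))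

  +-monoʳ-< : ∀ z {x y} → x < y → z + x < z + y
  +-monoʳ-< z x<y =
    <-respˡ-≈ (+-comm _ z) (<-respʳ-≈ (+-comm _ z) (+-monoˡ-< z x<y))

  +-monoˡ-≤ : ∀ z {x y} → x ≤ y → x + z ≤ y + z
  +-monoˡ-≤ z x≤y y+z<x+z = x≤y (+-cancelʳ-< z y+z<x+z)

  +-monoʳ-≤ : ∀ z {x y} → x ≤ y → z + x ≤ z + y
  +-monoʳ-≤ z x≤y z+y<z+x =
    +-monoˡ-≤ z x≤y (<-respˡ-≈ (+-comm z _) (<-respʳ-≈ (+-comm z _) z+y<z+x))

  +-mono-≤ : ∀ {x y u v} → x ≤ y → u ≤ v → x + u ≤ y + v
  +-mono-≤ x≤y u≤v = ≤-trans (+-monoˡ-≤ _ x≤y) (+-monoʳ-≤ _ u≤v)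

  +-cancelˡ-≤ : ∀ z {x y} → z + x ≤ z + y → x ≤ y
  +-cancelˡ-≤ z h y<x = h (+-monoʳ-< z y<x)

  x≤x+y : ∀ x {y} → 0# ≤ y → x ≤ x + y
  x≤x+y x 0≤y = ≤-trans (≤-reflexive (sym (+-identityʳ x))) (+-monoʳ-≤ x 0≤y)

  x<x+y : ∀ x {y} → 0# < y → x < x + y
  x<x+y x 0<y = <-respˡ-≈ (+-identityʳ x) (+-monoʳ-< x 0<y)

  +-nonNeg : ∀ {x y} → 0# ≤ x → 0# ≤ y → 0# ≤ x + y
  +-nonNeg 0≤x 0≤y = ≤-trans 0≤x (x≤x+y _ 0≤y)

  difference : ∀ x y → y ≈ x + (y - x)
  difference x y = begin-equality
    y              ≈⟨ +-identityʳ y ⟨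
    y + 0#         ≈⟨ +-congˡ (-‿inverseʳ x) ⟨
    y + (x - x)    ≈⟨ solve 3 (λ x y -x → y :+ (x :+ -x) := x :+ (y :+ -x))
                      refl x y (- x) ⟩
    x + (y - x)    ∎

  *-monoʳ-< : ∀ {z x y} → 0# < z → x < y → z * x < z * y
  *-monoʳ-< {z} {x} {y} 0<z x<y = begin-strict
    z * x                ≈⟨ +-identityʳ _ ⟨
    z * x + 0#           <⟨ +-monoʳ-< (z * x) (*-pos 0<z 0<y-x) ⟩
    z * x + z * (y - x)  ≈⟨ distribˡ z x (y - x) ⟨
    z * (x + (y - x))    ≈⟨ *-congˡ (difference x y) ⟨
    z * y                ∎
    where
    0<y-x : 0# < y - x
    0<y-x = <-respˡ-≈ (-‿inverseʳ x) (+-monoˡ-< (- x) x<y)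

  *-nonNeg : ∀ {x y} → 0# ≤ x → 0# ≤ y → 0# ≤ x * y
  *-nonNeg {x} {y} 0≤x 0≤y xy<0 = asym 0<product product<0
    where
    p : Carrier
    p = - (x * y)

    0<p : 0# < p
    0<p = <-respˡ-≈ (-‿inverseʳ (x * y))
            (<-respʳ-≈ (+-identityˡ p) (+-monoˡ-< p xy<0))

    N : Carrier
    N = (x + y) + (p + 1#)

    p<N : p < N
    p<N = <-≤-trans (x<x+y p 0<1)
      (≤-trans (≤-reflexive (sym (+-identityˡ _)))
               (+-monoˡ-≤ (p + 1#) (+-nonNeg 0≤x 0≤y)))

    w : Carrier
    w = proj₁ (inverse (<-trans 0<p p<N))

    0<w : 0# < w
    0<w = proj₁ (proj₂ (inverse (<-trans 0<p p<N)))

    Nw≈1 : N * w ≈ 1#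
    Nw≈1 = proj₂ (proj₂ (inverse (<-trans 0<p p<N)))

    ε : Carrier
    ε = w * p

    0<ε : 0# < ε
    0<ε = *-pos 0<w 0<p

    ε<p+1 : ε < p + 1#
    ε<p+1 = begin-strict
      w * p   <⟨ *-monoʳ-< 0<w p<N ⟩
      w * N   ≈⟨ *-comm w N ⟩
      N * w   ≈⟨ Nw≈1 ⟩
      1#      <⟨ x<x+y 1# 0<p ⟩
      1# + p  ≈⟨ +-comm 1# p ⟩
      p + 1#  ∎

    0<product : 0# < (x + ε) * (y + ε)
    0<product = *-pos (≤-<-trans 0≤x (x<x+y x 0<ε))
                      (≤-<-trans 0≤y (x<x+y y 0<ε))

    product<0 : (x + ε) * (y + ε) < 0#
    product<0 = begin-strict
      (x + ε) * (y + ε)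
        ≈⟨ solve 3 (λ x y ε → (x :+ ε) :* (y :+ ε)
                           := x :* y :+ ε :* ((x :+ y) :+ ε)) refl x y ε ⟩
      x * y + ε * ((x + y) + ε)
        <⟨ +-monoʳ-< (x * y) (*-monoʳ-< 0<ε (+-monoʳ-< (x + y) ε<p+1)) ⟩
      x * y + w * p * N
        ≈⟨ +-congˡ (solve 3 (λ w p N → w :* p :* N := p :* (N :* w)) refl w p N) ⟩
      x * y + p * (N * w)  ≈⟨ +-congˡ (*-congˡ Nw≈1) ⟩
      x * y + p * 1#       ≈⟨ +-congˡ (*-identityʳ p) ⟩
      x * y + p            ≈⟨ -‿inverseʳ (x * y) ⟩
      0#                   ∎

  *-monoʳ-≤ : ∀ {z x y} → 0# ≤ z → x ≤ y → z * x ≤ z * y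
  *-monoʳ-≤ {z} {x} {y} 0≤z x≤y = begin
    z * x                ≤⟨ x≤x+y (z * x) (*-nonNeg 0≤z 0≤y-x) ⟩
    z * x + z * (y - x)  ≈⟨ distribˡ z x (y - x) ⟨
    z * (x + (y - x))    ≈⟨ *-congˡ (difference x y) ⟨
    z * y                ∎
    where
    0≤y-x : 0# ≤ y - x
    0≤y-x = ≤-trans (≤-reflexive (sym (-‿inverseʳ x))) (+-monoˡ-≤ (- x) x≤y)

  *-monoˡ-≤ : ∀ {z x y} → 0# ≤ z → x ≤ y → x * z ≤ y * z
  *-monoˡ-≤ 0≤z x≤y = ≤-trans (≤-reflexive (*-comm _ _))
    (≤-trans (*-monoʳ-≤ 0≤z x≤y) (≤-reflexive (*-comm _ _)))

  abstract
    shrink : ∀ {C ε} → 0# ≤ C → 0# < ε → ∃[ δ ] 0# < δ × C * δ < ε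
    shrink {C} {ε} 0≤C 0<ε with inverse (≤-<-trans 0≤C (x<x+y C 0<1))
    ... | w , 0<w , [C+1]w≈1 = w * ε , *-pos 0<w 0<ε , (begin-strict
      C * (w * ε)           <⟨ x<x+y _ (*-pos 0<w 0<ε) ⟩
      C * (w * ε) + w * ε
        ≈⟨ +-congˡ (*-identityˡ _) ⟨
      C * (w * ε) + 1# * (w * ε)
        ≈⟨ solve 4 (λ C u w ε → C :* (w :* ε) :+ u :* (w :* ε)
                             := (C :+ u) :* w :* ε) refl C 1# w ε ⟩
      (C + 1#) * w * ε      ≈⟨ *-congʳ [C+1]w≈1 ⟩
      1# * ε                ≈⟨ *-identityˡ ε ⟩
      ε                     ∎)

  abstract
    0<×1 : ∀ n .{{_ : ℕ.NonZero n}} → 0# < n ×ℕ 1#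
    0<×1 1               = <-respʳ-≈ (sym (+-identityʳ 1#)) 0<1
    0<×1 (suc n@(suc _)) = <-trans (0<×1 n)
      (<-respʳ-≈ (+-comm _ 1#) (x<x+y (n ×ℕ 1#) 0<1))

  -- f and g increasing, with every increment of f bounded by C times the
  -- corresponding increment of g
  module Increments
    {f g d e : ℕ → Carrier} {C : Carrier} (0≤C : 0# ≤ C)
    (f-step : ∀ n → f (suc n) ≈ f n + d n)
    (g-step : ∀ n → g (suc n) ≈ g n + e n)
    (0≤d : ∀ n → 0# ≤ d n) (d≤Ce : ∀ n → d n ≤ C * e n)
    where

    mono : ∀ {m n} → m ℕ.≤′ n → f m ≤ f n
    mono ℕ.≤′-refl             = ≤-reflexive refl
    mono (ℕ.≤′-step {n} m≤n) = ≤-trans (mono m≤n)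
      (≤-trans (x≤x+y (f n) (0≤d n)) (≤-reflexive (sym (f-step n))))

    bound : ∀ {m n} → m ℕ.≤′ n → f n + C * g m ≤ f m + C * g n
    bound ℕ.≤′-refl = ≤-reflexive refl
    bound {m} (ℕ.≤′-step {n} m≤n) = begin
      f (suc n) + C * g m      ≈⟨ +-congʳ (f-step n) ⟩
      f n + d n + C * g m
        ≈⟨ solve 3 (λ a b c → a :+ b :+ c := a :+ c :+ b) refl (f n) (d n) (C * g m) ⟩
      f n + C * g m + d n      ≤⟨ +-mono-≤ (bound m≤n) (d≤Ce n) ⟩
      f m + C * g n + C * e n
        ≈⟨ solve 4 (λ a C g e → a :+ C :* g :+ C :* e := a :+ C :* (g :+ e))
             refl (f m) C (g n) (e n) ⟩
      f m + C * (g n + e n)    ≈⟨ +-congˡ (*-congˡ (g-step n)) ⟨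
      f m + C * g (suc n)      ∎

    close : ∀ {δ ε} → 0# < ε → C * δ < ε →
            ∀ {m n} → g m < g n + δ → f m < f n + ε
    close {δ} {ε} 0<ε Cδ<ε {m} {n} gm<gn+δ with ℕ.≤-total m n
    ... | inj₁ m≤n = ≤-<-trans (mono (ℕ.≤⇒≤′ m≤n)) (x<x+y (f n) 0<ε)
    ... | inj₂ n≤m = ≤-<-trans (+-cancelˡ-≤ (C * g n) (begin
      C * g n + f m           ≈⟨ +-comm _ _ ⟩
      f m + C * g n           ≤⟨ bound (ℕ.≤⇒≤′ n≤m) ⟩
      f n + C * g m           ≤⟨ +-monoʳ-≤ (f n) (*-monoʳ-≤ 0≤C (<⇒≤ gm<gn+δ)) ⟩
      f n + C * (g n + δ)
        ≈⟨ solve 4 (λ a C g δ → a :+ C :* (g :+ δ) := C :* g :+ (a :+ C :* δ))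
             refl (f n) C (g n) δ ⟩
      C * g n + (f n + C * δ) ∎)) (+-monoʳ-< (f n) Cδ<ε)

    cauchy : Cauchy g → Cauchy f
    cauchy g-cauchy 0<ε with shrink 0≤C 0<ε
    ... | δ , 0<δ , Cδ<ε with g-cauchy 0<δ
    ... | N , g-close = N , λ m n N≤m N≤n → close 0<ε Cδ<ε (g-close m n N≤m N≤n)

  module _ {a : ℕ → Carrier} (0≤a : ∀ n → 0# ≤ a n) {s : Carrier}
           (converges : partialSum a ⟶ s) where

    private module Self = Increments {partialSum a} {partialSum a} {a} {a} {1#}
              (<⇒≤ 0<1) (λ _ → refl) (λ _ → refl) 0≤a
              (λ n → ≤-reflexive (sym (*-identityˡ (a n))))

    partialSum≤sum : ∀ n → partialSum a n ≤ s
    partialSum≤sum n s<f with converges {partialSum a n - s}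
      (<-respˡ-≈ (-‿inverseʳ s) (+-monoˡ-< (- s) s<f))
    ... | N , close = Self.mono (ℕ.≤⇒≤′ (ℕ.m≤m⊔n n N))
      (<-respʳ-≈ (sym (difference s _)) (proj₁ (close (n ℕ.⊔ N) (ℕ.m≤n⊔m n N))))

  ⟶⇒cauchy : ∀ {f l} → f ⟶ l → Cauchy f
  ⟶⇒cauchy {f} {l} f⟶l {ε} 0<ε
    with shrink {1# + 1#} (+-nonNeg (<⇒≤ 0<1) (<⇒≤ 0<1)) 0<ε
  ... | δ , 0<δ , 2δ<ε with f⟶l 0<δ
  ... | N , close = N , λ m n N≤m N≤n → begin-strict
    f m              <⟨ proj₁ (close m N≤m) ⟩
    l + δ            <⟨ +-monoˡ-< δ (proj₂ (close n N≤n)) ⟩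
    f n + δ + δ
      ≈⟨ +-assoc _ _ _ ⟩
    f n + (δ + δ)
      ≈⟨ +-congˡ (+-cong (*-identityˡ δ) (*-identityˡ δ)) ⟨
    f n + (1# * δ + 1# * δ) ≈⟨ +-congˡ (distribʳ δ 1# 1#) ⟨
    f n + (1# + 1#) * δ  <⟨ +-monoʳ-< (f n) 2δ<ε ⟩
    f n + ε          ∎

  +-cauchy : ∀ {f g} → Cauchy f → Cauchy g → Cauchy (λ n → f n + g n)
  +-cauchy {f} {g} f-cauchy g-cauchy {ε} 0<ε
    with shrink {1# + 1#} (+-nonNeg (<⇒≤ 0<1) (<⇒≤ 0<1)) 0<ε
  ... | δ , 0<δ , 2δ<ε with f-cauchy 0<δ | g-cauchy 0<δ
  ... | M , f-close | N , g-close = M ℕ.⊔ N , λ m n ≤m ≤n → begin-strict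
    f m + g m
      <⟨ +-monoˡ-< (g m) (f-close m n (ℕ.m⊔n≤o⇒m≤o M N ≤m) (ℕ.m⊔n≤o⇒m≤o M N ≤n)) ⟩
    f n + δ + g m
      <⟨ +-monoʳ-< (f n + δ) (g-close m n (ℕ.m⊔n≤o⇒n≤o M N ≤m) (ℕ.m⊔n≤o⇒n≤o M N ≤n)) ⟩
    f n + δ + (g n + δ)
      ≈⟨ solve 3 (λ a b δ → a :+ δ :+ (b :+ δ) := a :+ b :+ (δ :+ δ)) refl (f n) (g n) δ ⟩
    f n + g n + (δ + δ)
      ≈⟨ +-congˡ (+-cong (*-identityˡ δ) (*-identityˡ δ)) ⟨
    f n + g n + (1# * δ + 1# * δ) ≈⟨ +-congˡ (distribʳ δ 1# 1#) ⟨
    f n + g n + (1# + 1#) * δ  <⟨ +-monoʳ-< (f n + g n) 2δ<ε ⟩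
    f n + g n + ε          ∎

-- For each k, the coefficients of z^k in the partial products of
-- ∏_{i≥1} (1 + β_i z)/(1 - α_i z) form a Cauchy sequence: they increase
-- with N, and by factor-⊛-suc each increment is at most a constant times
-- α_N + β_N.
module Convergence {c ℓ₁ ℓ₂} (R : Reals c ℓ₁ ℓ₂) where
  open Reals R
  open OrderProperties R
  open OverRing rawRing
  open SemiringSum semiring
    using (sum; sum-cong-≋; ∑-distrib-+; *-distribˡ-sum)
  open RingSolver commutativeSemiring
    using (solve; _:=_; _:+_; _:*_)

  factor : Carrier → Carrier → Series
  factor a b = (1+ b z) ⊛ 1/[1- a z]

  sum-zero : ∀ {n} {f : Fin n → Carrier} → (∀ i → f i ≈ 0#) → sum f ≈ 0#
  sum-zero {zero}  f≈0 = refl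
  sum-zero {suc n} f≈0 =
    trans (+-cong (f≈0 Fin.zero) (sum-zero λ i → f≈0 (Fin.suc i))) (+-identityˡ 0#)

  linear-⊛ : ∀ b G k → ((1+ b z) ⊛ G) (suc k) ≈ G (suc k) + b * G k
  linear-⊛ b G k = +-cong (*-identityˡ _)
    (trans (+-congˡ (sum-zero {k} λ _ → zeroˡ _)) (+-identityʳ _))

  factor-zero : ∀ a b → factor a b 0 ≈ 1#
  factor-zero a b = trans (+-identityʳ _) (*-identityˡ 1#)

  factor-suc : ∀ a b k → factor a b (suc k) ≈ a * factor a b k + b * 1ₛ k
  factor-suc a b zero = begin-equality
    factor a b 1              ≈⟨ linear-⊛ b 1/[1- a z] 0 ⟩
    a * 1# + b * 1#           ≈⟨ +-congʳ (*-congˡ (factor-zero a b)) ⟨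
    a * factor a b 0 + b * 1# ∎
  factor-suc a b (suc k) = begin-equality
    factor a b (suc (suc k))          ≈⟨ linear-⊛ b 1/[1- a z] (suc k) ⟩
    a * (a * a ^ k) + b * (a * a ^ k)
      ≈⟨ solve 3 (λ a b p → a :* (a :* p) :+ b :* (a :* p)
                         := a :* (a :* p :+ b :* p)) refl a b (a ^ k) ⟩
    a * (a * a ^ k + b * a ^ k)       ≈⟨ *-congˡ (linear-⊛ b 1/[1- a z] k) ⟨
    a * factor a b (suc k)            ≈⟨ +-identityʳ _ ⟨
    a * factor a b (suc k) + 0#       ≈⟨ +-congˡ (zeroʳ b) ⟨
    a * factor a b (suc k) + b * 0#   ∎

  1ₛ-⊛ : ∀ G k → (1ₛ ⊛ G) k ≈ G k
  1ₛ-⊛ G k = trans (+-cong (*-identityˡ _) (sum-zero {k} λ _ → zeroˡ _))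
                   (+-identityʳ _)

  factor-⊛-zero : ∀ a b G → (factor a b ⊛ G) 0 ≈ G 0
  factor-⊛-zero a b G = trans (+-identityʳ _)
    (trans (*-congʳ (factor-zero a b)) (*-identityˡ _))

  factor-⊛-suc : ∀ a b G k →
    (factor a b ⊛ G) (suc k) ≈ G (suc k) + (a * (factor a b ⊛ G) k + b * G k)
  factor-⊛-suc a b G k =
    +-cong (trans (*-congʳ (factor-zero a b)) (*-identityˡ _)) (begin-equality
      sum (λ i → F (suc (toℕ i)) * g i)
        ≈⟨ sum-cong-≋ split ⟩
      sum (λ i → a * (F (toℕ i) * g i) + b * (1ₛ (toℕ i) * g i))
        ≈⟨ ∑-distrib-+ (λ i → a * (F (toℕ i) * g i)) (λ i → b * (1ₛ (toℕ i) * g i)) ⟩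
      sum (λ i → a * (F (toℕ i) * g i)) + sum (λ i → b * (1ₛ (toℕ i) * g i))
        ≈⟨ +-cong (*-distribˡ-sum a (λ i → F (toℕ i) * g i))
                  (*-distribˡ-sum b (λ i → 1ₛ (toℕ i) * g i)) ⟨
      a * (F ⊛ G) k + b * (1ₛ ⊛ G) k
        ≈⟨ +-congˡ (*-congˡ (1ₛ-⊛ G k)) ⟩
      a * (F ⊛ G) k + b * G k ∎)
    where
    F : Series
    F = factor a b

    g : Fin (suc k) → Carrier
    g i = G (k ℕ.∸ toℕ i)

    split : ∀ i → F (suc (toℕ i)) * g i
                ≈ a * (F (toℕ i) * g i) + b * (1ₛ (toℕ i) * g i)
    split i = trans (*-congʳ (factor-suc a b (toℕ i)))
      (solve 5 (λ a b f u g → (a :* f :+ b :* u) :* g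
                           := a :* (f :* g) :+ b :* (u :* g))
         refl a b (F (toℕ i)) (1ₛ (toℕ i)) (g i))

  module _ {α β : ℕ → Carrier}
           (0≤α : ∀ i → 0# ≤ α i) (0≤β : ∀ i → 0# ≤ β i)
           (α-summable : Summable α) (β-summable : Summable β) where

    private
      P : ℕ → Series
      P N = ∏[ N ] (λ i → factor (α i) (β i))

      d : ℕ → ℕ → Carrier
      d k N = α N * P (suc N) k + β N * P N k

      P-step : ∀ k N → P (suc N) (suc k) ≈ P N (suc k) + d k N
      P-step k N = factor-⊛-suc (α N) (β N) (P N) k

      0≤P : ∀ k N → 0# ≤ P N k
      0≤P zero    zero    = <⇒≤ 0<1
      0≤P (suc k) zero    = ≤-reflexive refl
      0≤P zero    (suc N) = ≤-trans (0≤P 0 N)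
        (≤-reflexive (sym (factor-⊛-zero (α N) (β N) (P N))))
      0≤P (suc k) (suc N) = ≤-trans
        (+-nonNeg (0≤P (suc k) N)
          (+-nonNeg (*-nonNeg (0≤α N) (0≤P k (suc N)))
                    (*-nonNeg (0≤β N) (0≤P k N))))
        (≤-reflexive (sym (P-step k N)))

      0≤d : ∀ k N → 0# ≤ d k N
      0≤d k N = +-nonNeg (*-nonNeg (0≤α N) (0≤P k (suc N)))
                         (*-nonNeg (0≤β N) (0≤P k N))

      T : ℕ → Carrier
      T N = partialSum α N + partialSum β N

      T-step : ∀ N → T (suc N) ≈ T N + (α N + β N)
      T-step N = solve 4 (λ s a t b → (s :+ a) :+ (t :+ b) := (s :+ t) :+ (a :+ b))
        refl (partialSum α N) (α N) (partialSum β N) (β N)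

      L : Carrier
      L = proj₁ α-summable + proj₁ β-summable

      T≤L : ∀ N → T N ≤ L
      T≤L N = +-mono-≤ (partialSum≤sum 0≤α (proj₂ α-summable) N)
                       (partialSum≤sum 0≤β (proj₂ β-summable) N)

      T-cauchy : Cauchy T
      T-cauchy = +-cauchy (⟶⇒cauchy (proj₂ α-summable)) (⟶⇒cauchy (proj₂ β-summable))

      d≤ : ∀ k {C} → (∀ N → P N k ≤ C) → ∀ N → d k N ≤ C * (α N + β N)
      d≤ k {C} P≤C N = begin
        α N * P (suc N) k + β N * P N k
          ≤⟨ +-mono-≤ (*-monoʳ-≤ (0≤α N) (P≤C (suc N))) (*-monoʳ-≤ (0≤β N) (P≤C N)) ⟩
        α N * C + β N * C
          ≈⟨ solve 3 (λ a b C → a :* C :+ b :* C := C :* (a :+ b)) refl (α N) (β N) C ⟩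
        C * (α N + β N) ∎

      P-zero : ∀ N → P N 0 ≈ 1#
      P-zero zero    = refl
      P-zero (suc N) = trans (factor-⊛-zero (α N) (β N) (P N)) (P-zero N)

      bounded : ∀ k → ∃[ C ] (∀ N → P N k ≤ C)
      bounded zero = 1# , λ N → ≤-reflexive (P-zero N)
      bounded (suc k) with bounded k
      ... | C , P≤C = C * L , λ N → begin
        P N (suc k)                ≤⟨ x≤x+y _ (*-nonNeg 0≤C 0≤T₀) ⟩
        P N (suc k) + C * T 0
          ≤⟨ Increments.bound 0≤C (P-step k) T-step (0≤d k) (d≤ k P≤C)
               {0} {N} (ℕ.≤⇒≤′ ℕ.z≤n) ⟩
        0# + C * T N               ≈⟨ +-identityˡ _ ⟩
        C * T N                    ≤⟨ *-monoʳ-≤ 0≤C (T≤L N) ⟩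
        C * L                      ∎
        where
        0≤C  = ≤-trans (0≤P k 0) (P≤C 0)
        0≤T₀ = ≤-reflexive (sym (+-identityˡ 0#))

    abstract
      coefficients-cauchy : ∀ k →
        Cauchy (λ N → ∏[ N ] (λ i → factor (α i) (β i)) k)
      coefficients-cauchy zero {ε} 0<ε = 0 , λ m n _ _ →
        ≤-<-trans (≤-reflexive (trans (P-zero m) (sym (P-zero n)))) (x<x+y (P n 0) 0<ε)
      coefficients-cauchy (suc k) with bounded k
      ... | C , P≤C = Increments.cauchy (≤-trans (0≤P k 0) (P≤C 0))
        (P-step k) T-step (0≤d k) (d≤ k P≤C) T-cauchy

record Parameters {c ℓ₁ ℓ₂} (R : Reals c ℓ₁ ℓ₂) : Set (c ⊔ ℓ₂) where
  open Reals R
  field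
    α β        : ℕ → Carrier
    γ          : Carrier
    0≤α        : ∀ i → 0# ≤ α i
    0≤β        : ∀ i → 0# ≤ β i
    0≤γ        : 0# ≤ γ
    α-summable : Summable α
    β-summable : Summable β

module Extended {c ℓ₁ ℓ₂} (R : Reals c ℓ₁ ℓ₂) (p : Parameters R) where
  open Reals R
  open Parameters p
  open OrderProperties R using (0<×1)
  open Convergence R using (factor; coefficients-cauchy)
  open OverRing rawRing
  open PowerSeries commutativeRing public
    using (FPS; x; _•_; ∑∞; ∏1/[1-xw]; schur; HasSum; D)

  e^γz : Series
  e^γz k = γ ^ k * proj₁ (inverse (0<×1 (k !) {{k ℕ.!≢0}}))

  -- The coefficientwise limit of the finite products.
  ∏[1+βz]/[1-αz] : Series
  ∏[1+βz]/[1-αz] k =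
    proj₁ (complete (coefficients-cauchy 0≤α 0≤β α-summable β-summable k))

  h̃ : Series
  h̃ = e^γz ⊛ ∏[1+βz]/[1-αz]

  S : Partition → Carrier
  S λ′ = det {ℓ λ′} λ i j →
    atℤ h̃ ((+ lookup (parts λ′) i ℤ.- + toℕ i) ℤ.+ + toℕ j)

  -- The coefficient of z^k in
  -- e^{γz} ∏_r (1 + β_r z)/((1 - x_r/z)(1 - α_r z)): the sum over m ≥ 0 of the
  -- coefficient of z^{-m} in ∏_r (1 - x_r/z)⁻¹, which is homogeneous of
  -- degree m in x, times that of z^{k+m} in e^{γz} ∏_r (1 + β_r z)/(1 - α_r z).
  symbol : ℤ → FPS
  symbol k = ∑∞ λ m → atℤ h̃ (k ℤ.+ + m) • ∏1/[1-xw] m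

{-# OPTIONS --safe #-}

module Submission where

open import Algebra.Bundles using (CommutativeRing; RawRing)
import Algebra.Definitions.RawSemiring as RawSemiringDefinitions
import Algebra.Properties.Ring as RingProperties
import Algebra.Properties.Semiring.Sum as SemiringSum
import Algebra.Solver.Ring.NaturalCoefficients.Default as RingSolver
open import Data.Fin.Base using (Fin; zero; suc; toℕ; fromℕ; inject₁; punchIn; pinch)
import Data.Fin.Properties as Fin
open import Data.Integer.Base as ℤ using (ℤ; +_)
import Data.Integer.Properties as ℤ
import Data.Integer.Solver as ℤ
open import Data.List.Base as List using (List; []; _∷_; _∷ʳ_; _++_; upTo; length)
import Data.List.Membership.Propositional.Properties as ∈
import Data.List.Membership.Propositional.Properties.WithK as ∈
open import Data.List.Membership.Propositional using (_∈_)
import Data.List.Properties as List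
open import Data.List.Relation.Binary.BagAndSetEquality using (∼bag⇒↭)
open import Data.List.Relation.Binary.Permutation.Propositional as Perm using (_↭_)
open import Data.List.Relation.Binary.Subset.Propositional using (_⊆_)
open import Data.List.Relation.Unary.All as All using (All; []; _∷_)
import Data.List.Relation.Unary.All.Properties as All
open import Data.List.Relation.Unary.AllPairs using ([]; _∷_)
open import Data.List.Relation.Unary.Any using (here)
open import Data.List.Relation.Unary.Linked as Linked using (Linked; []; [-]; _∷_)
import Data.List.Relation.Unary.Linked.Properties as Linked
open import Data.List.Relation.Unary.Unique.Propositional using (Unique)
import Data.List.Relation.Unary.Unique.Propositional.Properties as Unique
open import Data.List.Reverse using (Reverse; []; _∶_∶ʳ_; reverseView)
open import Data.Nat.Base as ℕ using (ℕ; zero; suc; _≤_; _<_; z≤n; s≤s; s≤s⁻¹)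
import Data.Nat.Properties as ℕ
open import Data.Product.Base using (∃-syntax; _×_; _,_; proj₁; proj₂)
open import Data.Unit.Base using (⊤; tt)
open import Data.Vec.Base as Vec using (Vec; []; _∷_; toList)
import Data.Vec.Properties as Vec
open import Defs
open import Function.Base using (_∘_; id; _$_)
open import Function.Bundles using (mk⇔)
open import Level using (Level)
open import Relation.Binary.PropositionalEquality as ≡ using (_≡_)
import Relation.Binary.Reasoning.Setoid as SetoidReasoning
open import Relation.Nullary.Decidable using (Dec; yes; no; _×-dec_)
open import Relation.Nullary.Negation using (¬_; contradiction)

-- Let a_k be the coefficient of z^k in the symbol, and Φ_μ(λ) the coefficient
-- of x^μ in det (a_{λᵢ-i+j}), where λ has n parts.  The coefficient of x^μ in
-- a_k is h̃_{k+|μ|}, so multilinearity in the rows gives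
-- Φ_{a,μ}(λ) = ∑ Φ_μ(ν), the sum being over all ν ≥ λ entrywise with
-- |ν| = |λ| + a.  As Φ_μ is alternating, the terms in which ν/λ is not a
-- horizontal strip cancel.  Iterating from λ = ∅, where Φ_μ(∅) is the
-- coefficient of the Toeplitz determinant, one builds all tableaux of content
-- μ with at most n rows, and a tableau of shape λ contributes
-- det (h̃_{λᵢ-i+j}) = S_λ.

-- The coefficient of x^μ in a determinant of series is in general not itself such a determinant;
-- for μ = ∅ it is, over the ring of scalars. That Φ_μ is alternating is therefore proved by
-- induction on μ, alongside the expansion: the sum of an alternating function over all ν ≥ λ of
-- given size is again alternating in λ. One reflection gives both this and the cancellation. In the
-- coordinates (νᵢ, νᵢ₊₁ - 1) the exchange of two adjacent rows is the reflection in the diagonal,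
-- and the range νᵢ ≥ k, νᵢ₊₁ > l is the quadrant with corner (k, l). Reflection turns it into the
-- quadrant with corner (l, k), whence alternation. The terms with νᵢ₊₁ > λᵢ fill the quadrant with
-- corner (λᵢ, λᵢ), which is its own mirror image, so they cancel. The scalars form an arbitrary
-- commutative ring, where 2 may be a zero divisor, so vanishing at the fixed points of an exchange
-- is carried along as a property of its own.

private variable
  ℓᴬ ℓᴮ ℓᴾ ℓᑫ : Level
  A : Set ℓᴬ
  B : Set ℓᴮ
  P : Set ℓᴾ
  Q : Set ℓᑫ
  n : ℕ

-- Finite sums over lists, with Iverson brackets.

module ListSums {c ℓᴷ} (K : CommutativeRing c ℓᴷ) where
  open CommutativeRing K hiding (zero)
  open SetoidReasoning setoid
  open SemiringSum semiring using (sum)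

  infixr 8 [_]_
  -- An Iverson bracket taking the decision itself, so that ranges of summation become conditions on
  -- the terms and can be compared term by term.
  [_]_ : Dec P → Carrier → Carrier
  [ yes _ ] x = x
  [ no  _ ] x = 0#

  []-cong : (p? : Dec P) (q? : Dec Q) → (P → Q) → (Q → P) →
            ∀ {x y} → (P → x ≈ y) → [ p? ] x ≈ [ q? ] y
  []-cong (yes p) (yes q) _   _   x≈y = x≈y p
  []-cong (yes p) (no ¬q) p⇒q _   _   = contradiction (p⇒q p) ¬q
  []-cong (no ¬p) (yes q) _   q⇒p _   = contradiction (q⇒p q) ¬p
  []-cong (no ¬p) (no ¬q) _   _   _   = refl

  []-congʳ : (p? : Dec P) → ∀ {x y} → (P → x ≈ y) → [ p? ] x ≈ [ p? ] y
  []-congʳ p? = []-cong p? p? id id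

  []-true : (p? : Dec P) → P → ∀ {x} → [ p? ] x ≈ x
  []-true (yes _) p = refl
  []-true (no ¬p) p = contradiction p ¬p

  []-false : (p? : Dec P) → ¬ P → ∀ {x} → [ p? ] x ≈ 0#
  []-false (yes p) ¬p = contradiction p ¬p
  []-false (no _)  ¬p = refl

  []-zero : (p? : Dec P) → ∀ {x} → (P → x ≈ 0#) → [ p? ] x ≈ 0#
  []-zero (yes p) x≈0 = x≈0 p
  []-zero (no _)  x≈0 = refl

  []-+ : (p? : Dec P) → ∀ x y → [ p? ] (x + y) ≈ [ p? ] x + [ p? ] y
  []-+ (yes _) x y = refl
  []-+ (no _)  x y = sym (+-identityˡ 0#)

  []-* : (p? : Dec P) → ∀ x y → [ p? ] (x * y) ≈ x * [ p? ] y
  []-* (yes _) x y = refl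
  []-* (no _)  x y = sym (zeroʳ x)

  []-comm : (p? : Dec P) (q? : Dec Q) → ∀ x → [ p? ] [ q? ] x ≈ [ q? ] [ p? ] x
  []-comm (yes _) (yes _) x = refl
  []-comm (yes _) (no _)  x = refl
  []-comm (no _)  (yes _) x = refl
  []-comm (no _)  (no _)  x = refl

  []-× : (p? : Dec P) (q? : Dec Q) → ∀ x → [ p? ×-dec q? ] x ≈ [ p? ] [ q? ] x
  []-× (yes _) (yes _) x = refl
  []-× (yes _) (no _)  x = refl
  []-× (no _)  _       x = refl

  []-split : (p? : Dec P) (q? : Dec Q) → (P → ¬ Q) → (¬ P → Q) →
             ∀ x → x ≈ [ p? ] x + [ q? ] x
  []-split (yes p) (yes q) p⇒¬q _ x = contradiction q (p⇒¬q p)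
  []-split (yes p) (no ¬q) _ _    x = sym (+-identityʳ x)
  []-split (no ¬p) (yes q) _ _    x = sym (+-identityˡ x)
  []-split (no ¬p) (no ¬q) _ ¬p⇒q x = contradiction (¬p⇒q ¬p) ¬q

  ∑ : List A → (A → Carrier) → Carrier
  ∑ xs f = List.foldr (λ x s → f x + s) 0# xs

  infixr 6 ∑
  syntax ∑ xs (λ x → e) = ∑[ x ∈ xs ] e

  ∑-cong : (xs : List A) {f g : A → Carrier} → (∀ x → f x ≈ g x) → ∑ xs f ≈ ∑ xs g
  ∑-cong []       f≈g = refl
  ∑-cong (x ∷ xs) f≈g = +-cong (f≈g x) (∑-cong xs f≈g)

  ∑-0 : (xs : List A) {f : A → Carrier} → (∀ x → f x ≈ 0#) → ∑ xs f ≈ 0#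
  ∑-0 []       f≈0 = refl
  ∑-0 (x ∷ xs) f≈0 = trans (+-cong (f≈0 x) (∑-0 xs f≈0)) (+-identityˡ 0#)

  +-interchange : ∀ w x y z → (w + x) + (y + z) ≈ (w + y) + (x + z)
  +-interchange w x y z = begin
    (w + x) + (y + z) ≈⟨ +-assoc w x (y + z) ⟩
    w + (x + (y + z)) ≈⟨ +-congˡ (trans (sym (+-assoc x y z))
                           (trans (+-congʳ (+-comm x y)) (+-assoc y x z))) ⟩
    w + (y + (x + z)) ≈⟨ +-assoc w y (x + z) ⟨
    (w + y) + (x + z) ∎

  ∑-+ : (xs : List A) (f g : A → Carrier) →
        ∑[ x ∈ xs ] (f x + g x) ≈ ∑ xs f + ∑ xs g
  ∑-+ []       f g = sym (+-identityˡ 0#)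
  ∑-+ (x ∷ xs) f g = trans (+-congˡ (∑-+ xs f g)) (+-interchange _ _ _ _)

  ∑-*ˡ : (xs : List A) → ∀ y (f : A → Carrier) → ∑[ x ∈ xs ] (y * f x) ≈ y * ∑ xs f
  ∑-*ˡ []       y f = sym (zeroʳ y)
  ∑-*ˡ (x ∷ xs) y f = trans (+-congˡ (∑-*ˡ xs y f)) (sym (distribˡ y _ _))

  ∑-[] : (p? : Dec P) (xs : List A) (f : A → Carrier) →
         ∑[ x ∈ xs ] [ p? ] f x ≈ [ p? ] ∑ xs f
  ∑-[] (yes _) xs f = refl
  ∑-[] (no _)  xs f = ∑-0 xs λ _ → refl

  ∑-swap : (xs : List A) (ys : List B) (f : A → B → Carrier) →
           ∑[ x ∈ xs ] ∑[ y ∈ ys ] f x y ≈ ∑[ y ∈ ys ] ∑[ x ∈ xs ] f x y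
  ∑-swap []       ys f = sym (∑-0 ys λ _ → refl)
  ∑-swap (x ∷ xs) ys f = trans (+-congˡ (∑-swap xs ys f))
                               (sym (∑-+ ys (f x) _))

  ∑-++ : (xs ys : List A) (f : A → Carrier) → ∑ (xs ++ ys) f ≈ ∑ xs f + ∑ ys f
  ∑-++ []       ys f = sym (+-identityˡ _)
  ∑-++ (x ∷ xs) ys f = trans (+-congˡ (∑-++ xs ys f)) (sym (+-assoc _ _ _))

  ∑-map : (g : A → B) (xs : List A) (f : B → Carrier) →
          ∑ (List.map g xs) f ≈ ∑ xs (f ∘ g)
  ∑-map g []       f = refl
  ∑-map g (x ∷ xs) f = +-congˡ (∑-map g xs f)

  ∑-product : ∀ {d} {C : Set d} (g : A → B → C) (xs : List A) (ys : List B) f →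
    ∑ (List.cartesianProductWith g xs ys) f ≈ ∑[ x ∈ xs ] ∑[ y ∈ ys ] f (g x y)
  ∑-product g []       ys f = refl
  ∑-product g (x ∷ xs) ys f = trans (∑-++ (List.map (g x) ys) _ f)
    (+-cong (∑-map (g x) ys f) (∑-product g xs ys f))

  ∑-filter : ∀ {p} {P : A → Set p} (P? : ∀ x → Dec (P x)) (xs : List A) f →
             ∑ (List.filter P? xs) f ≈ ∑[ x ∈ xs ] [ P? x ] f x
  ∑-filter P? []       f = refl
  ∑-filter P? (x ∷ xs) f with P? x
  ... | yes _ = +-congˡ (∑-filter P? xs f)
  ... | no _  = trans (∑-filter P? xs f) (sym (+-identityˡ _))

  ∑-↭ : {xs ys : List A} → xs ↭ ys → ∀ f → ∑ xs f ≈ ∑ ys f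
  ∑-↭ Perm.refl         f = refl
  ∑-↭ (Perm.prep x r)   f = +-congˡ (∑-↭ r f)
  ∑-↭ (Perm.swap x y r) f = trans (+-congˡ (+-congˡ (∑-↭ r f)))
    (trans (sym (+-assoc _ _ _)) (trans (+-congʳ (+-comm _ _)) (+-assoc _ _ _)))
  ∑-↭ (Perm.trans r s)  f = trans (∑-↭ r f) (∑-↭ s f)

  ∑-applyUpTo : (g : ℕ → A) → ∀ n f →
                ∑ (List.applyUpTo g n) f ≈ ∑[ k ∈ upTo n ] f (g k)
  ∑-applyUpTo g zero    f = refl
  ∑-applyUpTo g (suc n) f = +-congˡ (trans (∑-applyUpTo (g ∘ suc) n f)
    (sym (∑-applyUpTo suc n (f ∘ g))))

  ∑-upTo-suc : ∀ n f → ∑ (upTo (suc n)) f ≈ f 0 + (∑[ k ∈ upTo n ] f (suc k))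
  ∑-upTo-suc n f = +-congˡ (∑-applyUpTo suc n f)

  sum≈∑ : ∀ n f → sum {n} (f ∘ toℕ) ≈ ∑ (upTo n) f
  sum≈∑ zero    f = refl
  sum≈∑ (suc n) f = trans (+-congˡ (sum≈∑ n (f ∘ suc))) (sym (∑-upTo-suc n f))

  ∑-cong-upTo : ∀ n {f g : ℕ → Carrier} → (∀ k → k < n → f k ≈ g k) →
                ∑ (upTo n) f ≈ ∑ (upTo n) g
  ∑-cong-upTo zero    f≈g = refl
  ∑-cong-upTo (suc n) f≈g = trans (∑-upTo-suc n _)
    (trans (+-cong (f≈g 0 (s≤s z≤n))
                   (∑-cong-upTo n λ k k<n → f≈g (suc k) (s≤s k<n)))
           (sym (∑-upTo-suc n _)))

  ∑-upTo-extend : ∀ {m n} → m ≤ n → ∀ {f : ℕ → Carrier} →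
    (∀ k → m ≤ k → k < n → f k ≈ 0#) → ∑ (upTo m) f ≈ ∑ (upTo n) f
  ∑-upTo-extend {n = n} z≤n f≈0 =
    sym (trans (∑-cong-upTo n λ k → f≈0 k z≤n) (∑-0 (upTo n) λ _ → refl))
  ∑-upTo-extend {suc m} {suc n} (s≤s m≤n) {f} f≈0 = trans (∑-upTo-suc m f)
    (trans (+-congˡ (∑-upTo-extend m≤n λ k m≤k k<n → f≈0 (suc k) (s≤s m≤k) (s≤s k<n)))
           (sym (∑-upTo-suc n f)))

  ∑-upTo-shift : ∀ {n} p → p ≤ n → ∀ (f : ℕ → Carrier) →
    ∑[ k ∈ upTo n ] [ p ℕ.≤? k ] f k ≈ ∑[ k ∈ upTo (n ℕ.∸ p) ] f (p ℕ.+ k)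
  ∑-upTo-shift {n} zero    _         f = ∑-cong (upTo n) λ k → []-true (0 ℕ.≤? k) z≤n
  ∑-upTo-shift {suc n} (suc p) (s≤s p≤n) f = begin
    ∑[ k ∈ upTo (suc n) ] [ suc p ℕ.≤? k ] f k
      ≈⟨ ∑-upTo-suc n _ ⟩
    [ suc p ℕ.≤? 0 ] f 0 + (∑[ k ∈ upTo n ] [ suc p ℕ.≤? suc k ] f (suc k))
      ≈⟨ +-cong refl
                (∑-cong (upTo n) λ k → []-cong (suc p ℕ.≤? suc k) (p ℕ.≤? k)
                  s≤s⁻¹ s≤s λ _ → refl) ⟩
    0# + (∑[ k ∈ upTo n ] [ p ℕ.≤? k ] f (suc k))
      ≈⟨ +-identityˡ _ ⟩
    ∑[ k ∈ upTo n ] [ p ℕ.≤? k ] f (suc k)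
      ≈⟨ ∑-upTo-shift p p≤n (f ∘ suc) ⟩
    ∑[ k ∈ upTo (n ℕ.∸ p) ] f (suc p ℕ.+ k) ∎

  -- Off the diagonal the terms cancel in pairs. The diagonal has its own hypothesis, since
  -- `anti x x` says only that twice `g x x` is zero.
  ∑-alternating : (xs : List A) (g : A → A → Carrier) →
    (∀ x y → g x y + g y x ≈ 0#) → (∀ x → g x x ≈ 0#) →
    ∑[ x ∈ xs ] ∑[ y ∈ xs ] g x y ≈ 0#
  ∑-alternating []       g anti diag = refl
  ∑-alternating (x ∷ xs) g anti diag = begin
    (g x x + ∑ xs (g x)) + (∑[ y ∈ xs ] (g y x + ∑ xs (g y)))
      ≈⟨ +-cong (trans (+-congʳ (diag x)) (+-identityˡ _)) (∑-+ xs (λ y → g y x) _) ⟩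
    ∑ xs (g x) + ((∑[ y ∈ xs ] g y x) + (∑[ y ∈ xs ] ∑ xs (g y)))
      ≈⟨ +-congˡ (trans (+-congˡ (∑-alternating xs g anti diag)) (+-identityʳ _)) ⟩
    ∑ xs (g x) + (∑[ y ∈ xs ] g y x)
      ≈⟨ ∑-+ xs (g x) (λ y → g y x) ⟨
    ∑[ y ∈ xs ] (g x y + g y x)
      ≈⟨ ∑-0 xs (anti x) ⟩
    0# ∎

  ∑-single : ∀ {m n} → m < n → ∀ (f : ℕ → Carrier) →
             ∑[ k ∈ upTo n ] [ k ℕ.≟ m ] f k ≈ f m
  ∑-single {zero}  {suc n} _         f = trans (∑-upTo-suc n _)
    (trans (+-congˡ (∑-0 (upTo n) λ _ → refl)) (+-identityʳ _))
  ∑-single {suc m} {suc n} (s≤s m<n) f = trans (∑-upTo-suc n _)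
    (trans (+-identityˡ _)
      (trans (∑-cong (upTo n) λ k → []-cong (suc k ℕ.≟ suc m) (k ℕ.≟ m)
               ℕ.suc-injective (≡.cong suc) λ _ → refl)
             (∑-single m<n (f ∘ suc))))

-- Vectors of row lengths: containment, horizontal strips, row exchanges.

∣_∣ : Vec ℕ n → ℕ
∣ v ∣ = size (toList v)

first : Vec ℕ n → ℕ
first v = firstPart (toList v)

infix 4 _≼_ _≼?_
_≼_ : Vec ℕ n → Vec ℕ n → Set
[]      ≼ []      = ⊤
(k ∷ v) ≼ (l ∷ w) = k ≤ l × v ≼ w

_≼?_ : (v w : Vec ℕ n) → Dec (v ≼ w)
[]      ≼? []      = yes tt
(k ∷ v) ≼? (l ∷ w) = (k ℕ.≤? l) ×-dec (v ≼? w)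

-- The smaller vector v comes first: w₁ ≥ v₁ ≥ w₂ ≥ v₂ ≥ ..., the interlacing of `removeStrip`. In
-- the last row the lower bound `first []` is 0.
Strip : Vec ℕ n → Vec ℕ n → Set
Strip []      []      = ⊤
Strip (k ∷ v) (l ∷ w) = k ≤ l × first w ≤ k × Strip v w

strip? : (v w : Vec ℕ n) → Dec (Strip v w)
strip? []      []      = yes tt
strip? (k ∷ v) (l ∷ w) = (k ℕ.≤? l) ×-dec ((first w ℕ.≤? k) ×-dec strip? v w)

Decreasing : Vec ℕ n → Set
Decreasing []      = ⊤
Decreasing (k ∷ v) = first v ≤ k × Decreasing v

strip⇒decreasing : (v w : Vec ℕ n) → Strip v w → Decreasing w
strip⇒decreasing []      []      _                    = tt
strip⇒decreasing (k ∷ v) (l ∷ w) (k≤l , w≤k , strip) =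
  ℕ.≤-trans w≤k k≤l , strip⇒decreasing v w strip

-- Exchanging two adjacent rows of det (h (λᵢ - i + j)) has this effect on λ.
data Swap : Vec ℕ n → Vec ℕ n → Set where
  here  : ∀ {k l} {v : Vec ℕ n} → Swap (k ∷ suc l ∷ v) (l ∷ suc k ∷ v)
  there : ∀ {k} {v w : Vec ℕ n} → Swap v w → Swap (k ∷ v) (k ∷ w)

swap-size : {v w : Vec ℕ n} → Swap v w → ∣ v ∣ ≡ ∣ w ∣
swap-size (here {k = k} {l} {v}) = begin
  k ℕ.+ (suc l ℕ.+ ∣ v ∣) ≡⟨ ℕ.+-suc k (l ℕ.+ ∣ v ∣) ⟩
  suc (k ℕ.+ (l ℕ.+ ∣ v ∣)) ≡⟨ ≡.cong suc (≡.sym (ℕ.+-assoc k l ∣ v ∣)) ⟩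
  suc (k ℕ.+ l ℕ.+ ∣ v ∣)   ≡⟨ ≡.cong (λ m → suc (m ℕ.+ ∣ v ∣)) (ℕ.+-comm k l) ⟩
  suc (l ℕ.+ k ℕ.+ ∣ v ∣)   ≡⟨ ≡.cong suc (ℕ.+-assoc l k ∣ v ∣) ⟩
  suc (l ℕ.+ (k ℕ.+ ∣ v ∣)) ≡⟨ ℕ.+-suc l (k ℕ.+ ∣ v ∣) ⟨
  l ℕ.+ (suc k ℕ.+ ∣ v ∣) ∎
  where open ≡.≡-Reasoning
swap-size (there {k = k} s) = ≡.cong (k ℕ.+_) (swap-size s)

-- The bound grows along the vector so that the range of two adjacent
-- entries is preserved by Swap.
box : ℕ → ∀ n → List (Vec ℕ n)
box b zero    = [] ∷ []
box b (suc n) = List.cartesianProductWith _∷_ (upTo b) (box (suc b) n)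

-- Alternating functions on vectors, and the cancellation of all terms that are not strips.

module Cancellation {c ℓᴷ} (K : CommutativeRing c ℓᴷ) where
  open CommutativeRing K hiding (zero)
  open SetoidReasoning setoid
  open ListSums K

  ∑-box : ∀ b n (f : Vec ℕ (suc n) → Carrier) →
    ∑ (box b (suc n)) f ≈ ∑[ k ∈ upTo b ] ∑[ v ∈ box (suc b) n ] f (k ∷ v)
  ∑-box b n f = ∑-product _∷_ (upTo b) (box (suc b) n) f

  -- `Swap` exchanges the values λᵢ - i of two adjacent rows. `Swap v v` holds when an entry k is
  -- followed by k + 1, that is, when the two values coincide; `antisym` alone would then give only
  -- that twice `Φ v` is zero.
  record Alternating (Φ : Vec ℕ n → Carrier) : Set ℓᴷ where
    constructor alternating
    field
      antisym : ∀ {v w} → Swap v w → Φ v + Φ w ≈ 0#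
      diag    : ∀ {v} → Swap v v → Φ v ≈ 0#

  open Alternating

  tail-alternating : ∀ k {Φ : Vec ℕ (suc n) → Carrier} →
                     Alternating Φ → Alternating (Φ ∘ (k ∷_))
  tail-alternating k alt = alternating (antisym alt ∘ there) (diag alt ∘ there)

  size-alternating : ∀ m {Φ : Vec ℕ n → Carrier} → Alternating Φ →
                     Alternating (λ v → [ ∣ v ∣ ℕ.≟ m ] Φ v)
  size-alternating m {Φ} alt = alternating
    (λ {v} {w} s → begin
      [ ∣ v ∣ ℕ.≟ m ] Φ v + [ ∣ w ∣ ℕ.≟ m ] Φ w
        ≈⟨ +-congˡ ([]-cong (∣ w ∣ ℕ.≟ m) (∣ v ∣ ℕ.≟ m)
             (≡.trans (swap-size s)) (≡.trans (≡.sym (swap-size s))) λ _ → refl) ⟩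
      [ ∣ v ∣ ℕ.≟ m ] Φ v + [ ∣ v ∣ ℕ.≟ m ] Φ w
        ≈⟨ []-+ (∣ v ∣ ℕ.≟ m) (Φ v) (Φ w) ⟨
      [ ∣ v ∣ ℕ.≟ m ] (Φ v + Φ w)
        ≈⟨ []-zero (∣ v ∣ ℕ.≟ m) (λ _ → antisym alt s) ⟩
      0# ∎)
    (λ {v} s → []-zero (∣ v ∣ ℕ.≟ m) λ _ → diag alt s)

  module _ (Ψ : ℕ → ℕ → Carrier) where

    -- The offset in j is that of `Swap`: with j = j′ + 1 the range is k ≤ i < b, l ≤ j′ < b, on
    -- which `Swap` acts by (i, j′) ↦ (j′, i). The bound `suc b` is the one that `box` gives to the
    -- next entry.
    quadrant : ℕ → ℕ → ℕ → Carrier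
    quadrant b k l = ∑[ i ∈ upTo b ] [ k ℕ.≤? i ]
      (∑[ j ∈ upTo (suc b) ] [ suc l ℕ.≤? j ] Ψ i j)

    quadrant-shift : ∀ b k l → quadrant b k l ≈
      ∑[ i ∈ upTo b ] ∑[ j ∈ upTo b ] [ k ℕ.≤? i ] [ l ℕ.≤? j ] Ψ i (suc j)
    quadrant-shift b k l = ∑-cong (upTo b) λ i → begin
      [ k ℕ.≤? i ] (∑[ j ∈ upTo (suc b) ] [ suc l ℕ.≤? j ] Ψ i j)
        ≈⟨ []-congʳ (k ℕ.≤? i) (λ _ → trans (∑-upTo-suc b _)
             (+-identityˡ _)) ⟩
      [ k ℕ.≤? i ] (∑[ j ∈ upTo b ] [ suc l ℕ.≤? suc j ] Ψ i (suc j))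
        ≈⟨ ∑-[] (k ℕ.≤? i) (upTo b) _ ⟨
      ∑[ j ∈ upTo b ] [ k ℕ.≤? i ] [ suc l ℕ.≤? suc j ] Ψ i (suc j)
        ≈⟨ ∑-cong (upTo b) (λ j → []-congʳ (k ℕ.≤? i) λ _ →
             []-cong (suc l ℕ.≤? suc j) (l ℕ.≤? j) s≤s⁻¹ s≤s λ _ → refl) ⟩
      ∑[ j ∈ upTo b ] [ k ℕ.≤? i ] [ l ℕ.≤? j ] Ψ i (suc j) ∎

    module _ (anti : ∀ i j → Ψ i (suc j) + Ψ j (suc i) ≈ 0#) where

      quadrant-antisym : ∀ b k l → quadrant b k l + quadrant b l k ≈ 0#
      quadrant-antisym b k l = begin
        quadrant b k l + quadrant b l k
          ≈⟨ +-cong (quadrant-shift b k l)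
               (trans (quadrant-shift b l k) (∑-swap (upTo b) (upTo b) _)) ⟩
        (∑[ i ∈ upTo b ] ∑[ j ∈ upTo b ] [ k ℕ.≤? i ] [ l ℕ.≤? j ] Ψ i (suc j)) +
        (∑[ i ∈ upTo b ] ∑[ j ∈ upTo b ] [ l ℕ.≤? j ] [ k ℕ.≤? i ] Ψ j (suc i))
          ≈⟨ trans (∑-cong (upTo b) (λ i → ∑-+ (upTo b) _ _)) (∑-+ (upTo b) _ _) ⟨
        ∑[ i ∈ upTo b ] ∑[ j ∈ upTo b ]
          ([ k ℕ.≤? i ] [ l ℕ.≤? j ] Ψ i (suc j) + [ l ℕ.≤? j ] [ k ℕ.≤? i ] Ψ j (suc i))
          ≈⟨ ∑-0 (upTo b) (λ i → ∑-0 (upTo b) (vanish i)) ⟩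
        0# ∎
        where
        vanish : ∀ i j → [ k ℕ.≤? i ] [ l ℕ.≤? j ] Ψ i (suc j)
                       + [ l ℕ.≤? j ] [ k ℕ.≤? i ] Ψ j (suc i) ≈ 0#
        vanish i j = begin
          [ k ℕ.≤? i ] [ l ℕ.≤? j ] Ψ i (suc j) + [ l ℕ.≤? j ] [ k ℕ.≤? i ] Ψ j (suc i)
            ≈⟨ +-congˡ ([]-comm (l ℕ.≤? j) (k ℕ.≤? i) _) ⟩
          [ k ℕ.≤? i ] [ l ℕ.≤? j ] Ψ i (suc j) + [ k ℕ.≤? i ] [ l ℕ.≤? j ] Ψ j (suc i)
            ≈⟨ []-+ (k ℕ.≤? i) _ _ ⟨
          [ k ℕ.≤? i ] ([ l ℕ.≤? j ] Ψ i (suc j) + [ l ℕ.≤? j ] Ψ j (suc i))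
            ≈⟨ []-congʳ (k ℕ.≤? i) (λ _ → []-+ (l ℕ.≤? j) _ _) ⟨
          [ k ℕ.≤? i ] [ l ℕ.≤? j ] (Ψ i (suc j) + Ψ j (suc i))
            ≈⟨ []-zero (k ℕ.≤? i) (λ _ → []-zero (l ℕ.≤? j) λ _ → anti i j) ⟩
          0# ∎

      quadrant-diag : (∀ i → Ψ i (suc i) ≈ 0#) → ∀ b k → quadrant b k k ≈ 0#
      quadrant-diag diag b k = trans (quadrant-shift b k k)
        (∑-alternating (upTo b) (λ i j → [ k ℕ.≤? i ] [ k ℕ.≤? j ] Ψ i (suc j))
          (λ i j → begin
            [ k ℕ.≤? i ] [ k ℕ.≤? j ] Ψ i (suc j) + [ k ℕ.≤? j ] [ k ℕ.≤? i ] Ψ j (suc i)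
              ≈⟨ +-congˡ ([]-comm (k ℕ.≤? j) (k ℕ.≤? i) _) ⟩
            [ k ℕ.≤? i ] [ k ℕ.≤? j ] Ψ i (suc j) + [ k ℕ.≤? i ] [ k ℕ.≤? j ] Ψ j (suc i)
              ≈⟨ []-+ (k ℕ.≤? i) _ _ ⟨
            [ k ℕ.≤? i ] ([ k ℕ.≤? j ] Ψ i (suc j) + [ k ℕ.≤? j ] Ψ j (suc i))
              ≈⟨ []-zero (k ℕ.≤? i) (λ _ → trans (sym ([]-+ (k ℕ.≤? j) _ _))
                   ([]-zero (k ℕ.≤? j) λ _ → anti i j)) ⟩
            0# ∎)
          (λ i → []-zero (k ℕ.≤? i) λ _ → []-zero (k ℕ.≤? i) λ _ → diag i))

  above : ℕ → (Vec ℕ n → Carrier) → Vec ℕ n → Carrier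
  above b Φ v = ∑[ w ∈ box b _ ] [ v ≼? w ] Φ w

  above-∷ : ∀ b (Φ : Vec ℕ (suc n) → Carrier) k v → above b Φ (k ∷ v) ≈
            ∑[ i ∈ upTo b ] [ k ℕ.≤? i ] above (suc b) (Φ ∘ (i ∷_)) v
  above-∷ {n} b Φ k v = trans (∑-box b n _) (∑-cong (upTo b) λ i →
    trans (∑-cong (box (suc b) n) λ w → []-× (k ℕ.≤? i) (v ≼? w) _)
          (∑-[] (k ℕ.≤? i) (box (suc b) n) _))

  pairSum : ℕ → (Vec ℕ (suc (suc n)) → Carrier) → Vec ℕ n → ℕ → ℕ → Carrier
  pairSum b Φ v i j = above b (λ w → Φ (i ∷ j ∷ w)) v

  above-∷∷ : ∀ b (Φ : Vec ℕ (suc (suc n)) → Carrier) k l v →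
    above b Φ (k ∷ suc l ∷ v) ≈ quadrant (pairSum (suc (suc b)) Φ v) b k l
  above-∷∷ b Φ k l v = trans (above-∷ b Φ k (suc l ∷ v))
    (∑-cong (upTo b) λ i → []-congʳ (k ℕ.≤? i) λ _ → above-∷ (suc b) _ (suc l) v)

  module _ {Φ : Vec ℕ (suc (suc n)) → Carrier} (alt : Alternating Φ)
           (ψ : Vec ℕ n → Carrier → Carrier)
           (ψ-+ : ∀ v x y → ψ v (x + y) ≈ ψ v x + ψ v y)
           (ψ-0 : ∀ v {x} → x ≈ 0# → ψ v x ≈ 0#) (b : ℕ) where

    -- The weight `ψ w` depends on the tail `w` only, so exchanging the two leading entries leaves
    -- it alone. It is instantiated with the bracket of `above` and with that of a strip.
    pair-antisym : ∀ i j → (∑[ w ∈ box b n ] ψ w (Φ (i ∷ suc j ∷ w)))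
                         + (∑[ w ∈ box b n ] ψ w (Φ (j ∷ suc i ∷ w))) ≈ 0#
    pair-antisym i j = trans (sym (∑-+ (box b n) _ _)) (∑-0 (box b n) λ w →
      trans (sym (ψ-+ w _ _)) (ψ-0 w (antisym alt here)))

    pair-diag : ∀ i → (∑[ w ∈ box b n ] ψ w (Φ (i ∷ suc i ∷ w))) ≈ 0#
    pair-diag i = ∑-0 (box b n) λ w → ψ-0 w (diag alt here)

  -- Carries alternation from `coefficient μ` to `coefficient (a ∷ μ)`. The two exchanged rows range
  -- over a quadrant whose corner moves from (k, l) to (l, k), while the rows below range over the
  -- same set on both sides.
  above-alternating : ∀ b {Φ : Vec ℕ n → Carrier} → Alternating Φ →
                      Alternating (above b Φ)
  above-alternating b {Φ} alt = alternating (anti b alt) (dia b alt)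
    where
    anti : ∀ {n} b {Φ : Vec ℕ n → Carrier} → Alternating Φ →
           ∀ {v w} → Swap v w → above b Φ v + above b Φ w ≈ 0#
    anti b {Φ} alt (here {k = k} {l} {v}) =
      trans (+-cong (above-∷∷ b Φ k l v) (above-∷∷ b Φ l k v))
            (quadrant-antisym (pairSum (suc (suc b)) Φ v)
              (pair-antisym alt (λ w x → [ v ≼? w ] x) (λ w → []-+ (v ≼? w))
                (λ w eq → []-zero (v ≼? w) λ _ → eq) (suc (suc b)))
              b k l)
    anti {suc n} b {Φ} alt (there {k = k} {v} {w} s) =
      trans (+-cong (above-∷ b Φ k v) (above-∷ b Φ k w))
        (trans (sym (∑-+ (upTo b) _ _)) (∑-0 (upTo b) λ i →
          trans (sym ([]-+ (k ℕ.≤? i) _ _))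
            ([]-zero (k ℕ.≤? i) λ _ → anti (suc b) (tail-alternating i alt) s)))

    dia : ∀ {n} b {Φ : Vec ℕ n → Carrier} → Alternating Φ →
          ∀ {v} → Swap v v → above b Φ v ≈ 0#
    dia b {Φ} alt (here {k = k} {v = v}) =
      trans (above-∷∷ b Φ k k v)
            (quadrant-diag (pairSum (suc (suc b)) Φ v)
              (pair-antisym alt ψ ψ-+ ψ-0 (suc (suc b)))
              (pair-diag alt ψ ψ-+ ψ-0 (suc (suc b))) b k)
      where
      ψ : Vec ℕ _ → Carrier → Carrier
      ψ w x = [ v ≼? w ] x
      ψ-+ = λ w → []-+ (v ≼? w)
      ψ-0 : ∀ w {x} → x ≈ 0# → ψ w x ≈ 0#
      ψ-0 w eq = []-zero (v ≼? w) λ _ → eq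
    dia b {Φ} alt (there {k = k} {v} s) =
      trans (above-∷ b Φ k v) (∑-0 (upTo b) λ i → []-zero (k ℕ.≤? i) λ _ →
        dia (suc b) (tail-alternating i alt) s)

  strips : ℕ → (Vec ℕ n → Carrier) → Vec ℕ n → Carrier
  strips b Φ v = ∑[ w ∈ box b _ ] [ strip? v w ] Φ w

  strips-∷ : ∀ b (Φ : Vec ℕ (suc n) → Carrier) k v → strips b Φ (k ∷ v) ≈
    ∑[ i ∈ upTo b ] [ k ℕ.≤? i ]
      (∑[ w ∈ box (suc b) n ] [ first w ℕ.≤? k ] [ strip? v w ] Φ (i ∷ w))
  strips-∷ {n} b Φ k v = trans (∑-box b n _) (∑-cong (upTo b) λ i →
    trans (∑-cong (box (suc b) n) λ w →
      trans ([]-× (k ℕ.≤? i) ((first w ℕ.≤? k) ×-dec strip? v w) _)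
            ([]-congʳ (k ℕ.≤? i) λ _ → []-× (first w ℕ.≤? k) (strip? v w) _))
          (∑-[] (k ℕ.≤? i) (box (suc b) n) _))

  -- The terms with w₂ > v₁ cancel in pairs, the range of (w₁, w₂) being
  -- stable under Swap, and likewise in the later rows.
  above≈strips : ∀ b {Φ : Vec ℕ n → Carrier} → Alternating Φ →
                 ∀ v → Decreasing v → above b Φ v ≈ strips b Φ v
  above≈strips b alt [] _ = refl
  above≈strips b {Φ} alt (k ∷ []) _ = trans (above-∷ b Φ k [])
    (sym (trans (strips-∷ b Φ k []) (∑-cong (upTo b) λ i → []-congʳ (k ℕ.≤? i) λ _ →
      refl)))
  above≈strips {suc (suc n)} b {Φ} alt (k ∷ l ∷ v) (l≤k , dec) = begin
    above b Φ (k ∷ l ∷ v)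
      ≈⟨ above-∷ b Φ k (l ∷ v) ⟩
    ∑[ i ∈ upTo b ] [ k ℕ.≤? i ] above (suc b) (Φ ∘ (i ∷_)) (l ∷ v)
      ≈⟨ ∑-cong (upTo b) (λ i → []-congʳ (k ℕ.≤? i) λ _ →
           trans (above≈strips (suc b) (tail-alternating i alt) (l ∷ v) dec)
           (trans (∑-cong (box (suc b) (suc n)) λ w →
                     []-split (first w ℕ.≤? k) (suc k ℕ.≤? first w)
                       ℕ.≤⇒≯ ℕ.≰⇒> _)
                  (∑-+ (box (suc b) (suc n)) _ _))) ⟩
    ∑[ i ∈ upTo b ] [ k ℕ.≤? i ] (low i + high i)
      ≈⟨ trans (∑-cong (upTo b) λ i → []-+ (k ℕ.≤? i) (low i) (high i))
               (∑-+ (upTo b) _ _) ⟩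
    (∑[ i ∈ upTo b ] [ k ℕ.≤? i ] low i) + (∑[ i ∈ upTo b ] [ k ℕ.≤? i ] high i)
      ≈⟨ +-cong (sym (strips-∷ b Φ k (l ∷ v)))
           (trans (∑-cong (upTo b) λ i → []-congʳ (k ℕ.≤? i) λ _ → high≈ i)
             (quadrant-diag Ψ (pair-antisym alt ψ ψ-+ ψ-0 (suc (suc b)))
               (pair-diag alt ψ ψ-+ ψ-0 (suc (suc b))) b k)) ⟩
    strips b Φ (k ∷ l ∷ v) + 0#
      ≈⟨ +-identityʳ _ ⟩
    strips b Φ (k ∷ l ∷ v) ∎
    where
    low high : ℕ → Carrier
    low  i = ∑[ w ∈ box (suc b) (suc n) ] [ first w ℕ.≤? k ]
               [ strip? (l ∷ v) w ] Φ (i ∷ w)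
    high i = ∑[ w ∈ box (suc b) (suc n) ] [ suc k ℕ.≤? first w ]
               [ strip? (l ∷ v) w ] Φ (i ∷ w)

    ψ : Vec ℕ n → Carrier → Carrier
    ψ w x = [ (first w ℕ.≤? l) ×-dec strip? v w ] x

    ψ-+ : ∀ w x y → ψ w (x + y) ≈ ψ w x + ψ w y
    ψ-+ w = []-+ ((first w ℕ.≤? l) ×-dec strip? v w)

    ψ-0 : ∀ w {x} → x ≈ 0# → ψ w x ≈ 0#
    ψ-0 w x≈0 = []-zero ((first w ℕ.≤? l) ×-dec strip? v w) λ _ → x≈0

    Ψ : ℕ → ℕ → Carrier
    Ψ i j = ∑[ w ∈ box (suc (suc b)) n ] ψ w (Φ (i ∷ j ∷ w))

    -- The condition l ≤ j follows from l ≤ k < j. What remains on the two leading entries is i ≥ k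
    -- and j ≥ k + 1, the quadrant with corner (k, k).
    high≈ : ∀ i → high i ≈ ∑[ j ∈ upTo (suc b) ] [ suc k ℕ.≤? j ] Ψ i j
    high≈ i = trans (∑-box (suc b) n _) (∑-cong (upTo (suc b)) λ j →
      trans (∑-cong (box (suc (suc b)) n) λ w → []-congʳ (suc k ℕ.≤? j) λ k<j →
               trans ([]-× (l ℕ.≤? j) ((first w ℕ.≤? l) ×-dec strip? v w) _)
                     ([]-true (l ℕ.≤? j) (ℕ.≤-trans l≤k (ℕ.<⇒≤ k<j))))
            (∑-[] (suc k ℕ.≤? j) (box (suc (suc b)) n) _))

-- Determinants by expansion along the first row.

punchIn-pinch : (j : Fin (suc (suc n))) (k : Fin (suc n)) →
                punchIn (punchIn j k) (pinch k j) ≡ j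
punchIn-pinch zero    k       = ≡.refl
punchIn-pinch (suc j) zero    = ≡.refl
punchIn-pinch {suc n} (suc j) (suc k) = ≡.cong suc (punchIn-pinch j k)

-- Deleting column `j` and then the column at index `k` of the rest deletes `j` and `punchIn j k`.
-- In the opposite order the second deletion has index `pinch k j`, and the same columns are left.
punchIn-punchIn : (j : Fin (suc (suc n))) (k : Fin (suc n)) (l : Fin n) →
  punchIn (punchIn j k) (punchIn (pinch k j) l) ≡ punchIn j (punchIn k l)
punchIn-punchIn zero    k       l       = ≡.refl
punchIn-punchIn (suc j) zero    l       = ≡.refl
punchIn-punchIn {suc n} (suc j) (suc k) zero    = ≡.refl
punchIn-punchIn {suc n} (suc j) (suc k) (suc l) = ≡.cong suc (punchIn-punchIn j k l)

punchIn-inject₁ : (j : Fin (suc n)) (k : Fin n) →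
                  punchIn (inject₁ j) (inject₁ k) ≡ inject₁ (punchIn j k)
punchIn-inject₁ zero    k       = ≡.refl
punchIn-inject₁ (suc j) zero    = ≡.refl
punchIn-inject₁ (suc j) (suc k) = ≡.cong suc (punchIn-inject₁ j k)

punchIn-inject₁-fromℕ : (j : Fin (suc n)) → punchIn (inject₁ j) (fromℕ n) ≡ fromℕ (suc n)
punchIn-inject₁-fromℕ zero            = ≡.refl
punchIn-inject₁-fromℕ {suc n} (suc j) = ≡.cong suc (punchIn-inject₁-fromℕ j)

punchIn-fromℕ : (k : Fin n) → punchIn (fromℕ n) k ≡ inject₁ k
punchIn-fromℕ zero    = ≡.refl
punchIn-fromℕ (suc k) = ≡.cong suc (punchIn-fromℕ k)

module Determinants {c ℓᴷ} (K : CommutativeRing c ℓᴷ) where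
  open CommutativeRing K hiding (zero)
  open SetoidReasoning setoid
  open RingProperties ring using (-1*x≈-x; -‿distribˡ-*; -‿distribʳ-*; -‿involutive)
  open SemiringSum semiring
    using (sum; sum-cong-≋; ∑-distrib-+; *-distribˡ-sum; sum-init-last; sum-replicate-zero)
  open RingSolver commutativeSemiring using (solve; _:=_; _:*_)
  open OverRing rawRing
  open RawSemiringDefinitions (RawRing.rawSemiring rawRing) using (_^_)
  open Cancellation K

  private
    reflexive′ : ∀ {A : Set} (f : A → Carrier) {x y} → x ≡ y → f x ≈ f y
    reflexive′ f ≡.refl = refl

  -- sum and det unfold on suc n, which blocks the inference of their
  -- arguments; these copies do not.
  opaque
    ∑ᶠ : (Fin n → Carrier) → Carrier
    ∑ᶠ f = sum f

    Det : Matrix n → Carrier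
    Det M = det M

    Det≈det : (M : Matrix n) → Det M ≈ det M
    Det≈det M = refl

    ∑ᶠ-suc : (f : Fin (suc n) → Carrier) → ∑ᶠ f ≈ f zero + ∑ᶠ (f ∘ suc)
    ∑ᶠ-suc f = refl

    ∑ᶠ-last : (f : Fin (suc n) → Carrier) → ∑ᶠ f ≈ ∑ᶠ (f ∘ inject₁) + f (fromℕ n)
    ∑ᶠ-last f = sum-init-last f

    ∑ᶠ-cong : {f g : Fin n → Carrier} → (∀ i → f i ≈ g i) → ∑ᶠ f ≈ ∑ᶠ g
    ∑ᶠ-cong f≈g = sum-cong-≋ f≈g

    ∑ᶠ-+ : (f g : Fin n → Carrier) → ∑ᶠ (λ i → f i + g i) ≈ ∑ᶠ f + ∑ᶠ g
    ∑ᶠ-+ f g = ∑-distrib-+ f g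

    ∑ᶠ-*ˡ : ∀ x (f : Fin n → Carrier) → x * ∑ᶠ f ≈ ∑ᶠ λ i → x * f i
    ∑ᶠ-*ˡ x f = *-distribˡ-sum x f

    ∑ᶠ-zero : {f : Fin n → Carrier} → (∀ i → f i ≈ 0#) → ∑ᶠ f ≈ 0#
    ∑ᶠ-zero {n} f≈0 = trans (sum-cong-≋ f≈0) (sum-replicate-zero n)

    Det-zero : (M : Matrix 0) → Det M ≈ 1#
    Det-zero M = refl

    Det-suc : (M : Matrix (suc n)) → Det M ≈ ∑ᶠ λ j →
      (- 1#) ^ toℕ j * M zero j * Det λ i k → M (suc i) (punchIn j k)
    Det-suc M = refl

    Det-cong : {M N : Matrix n} → (∀ i j → M i j ≈ N i j) → Det M ≈ Det N
    Det-cong {zero}  M≈N = refl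
    Det-cong {suc n} M≈N = sum-cong-≋ λ j →
      *-cong (*-congˡ {(- 1#) ^ toℕ j} (M≈N zero j)) (Det-cong λ i k → M≈N (suc i) (punchIn j k))

  sign : Fin n → Carrier
  sign j = (- 1#) ^ toℕ j

  -- For columns j < j′, deleting j first gives the exponent j + (j′ - 1), as j′ has moved one place
  -- to the left; deleting j′ first gives j′ + j.
  sign-swap : (j : Fin (suc (suc n))) (k : Fin (suc n)) →
              sign (punchIn j k) * sign (pinch k j) ≈ - (sign j * sign k)
  sign-swap zero k = begin
    - 1# * sign k * 1#   ≈⟨ *-identityʳ _ ⟩
    - 1# * sign k        ≈⟨ -1*x≈-x (sign k) ⟩
    - sign k             ≈⟨ -‿cong (*-identityˡ (sign k)) ⟨
    - (1# * sign k)      ∎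
  sign-swap (suc j) zero = begin
    1# * sign j            ≈⟨ *-identityˡ _ ⟩
    sign j                 ≈⟨ -‿involutive _ ⟨
    - - sign j             ≈⟨ -‿cong (trans (*-identityʳ _) (-1*x≈-x (sign j))) ⟨
    - (- 1# * sign j * 1#) ∎
  sign-swap {suc n} (suc j) (suc k) = begin
    (- 1# * sign (punchIn j k)) * (- 1# * sign (pinch k j))
      ≈⟨ pull (sign (punchIn j k)) (sign (pinch k j)) ⟩
    (- 1# * - 1#) * (sign (punchIn j k) * sign (pinch k j))
      ≈⟨ *-congˡ (sign-swap j k) ⟩
    (- 1# * - 1#) * - (sign j * sign k)
      ≈⟨ -‿distribʳ-* _ _ ⟨
    - ((- 1# * - 1#) * (sign j * sign k))
      ≈⟨ -‿cong (pull (sign j) (sign k)) ⟨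
    - ((- 1# * sign j) * (- 1# * sign k)) ∎
    where
    pull : ∀ x y → (- 1# * x) * (- 1# * y) ≈ (- 1# * - 1#) * (x * y)
    pull = solve 3 (λ s x y → (s :* x) :* (s :* y) := (s :* s) :* (x :* y)) refl (- 1#)

  -- (j , k) ↦ (punchIn j k , pinch k j) exchanges the order in which the
  -- columns j and punchIn j k are removed.
  ∑ᶠ-cancel : ∀ n (f : Fin (suc (suc n)) → Fin (suc n) → Carrier) →
    (∀ j k → f (punchIn j k) (pinch k j) + f j k ≈ 0#) →
    ∑ᶠ (λ j → ∑ᶠ (f j)) ≈ 0#
  ∑ᶠ-cancel n f cancel = begin
    ∑ᶠ (λ j → ∑ᶠ (f j))
      ≈⟨ trans (∑ᶠ-suc _) (+-congˡ (∑ᶠ-cong λ j → ∑ᶠ-suc (f (suc j)))) ⟩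
    ∑ᶠ (f zero) + ∑ᶠ (λ j → f (suc j) zero + ∑ᶠ (λ k → f (suc j) (suc k)))
      ≈⟨ +-congˡ (∑ᶠ-+ _ _) ⟩
    ∑ᶠ (f zero) + (∑ᶠ (λ j → f (suc j) zero) + rest n f)
      ≈⟨ +-assoc _ _ _ ⟨
    ∑ᶠ (f zero) + ∑ᶠ (λ j → f (suc j) zero) + rest n f
      ≈⟨ +-congʳ (∑ᶠ-+ _ _) ⟨
    ∑ᶠ (λ k → f zero k + f (suc k) zero) + rest n f
      -- `(zero , k)` is matched with `(suc k , zero)`, and `rest` is the same sum one size smaller.
      -- Each pair is met once, so nothing has to be halved.
      ≈⟨ +-cong (∑ᶠ-zero λ k → trans (+-comm _ _) (cancel zero k)) (rest≈0 n f cancel) ⟩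
    0# + 0#
      ≈⟨ +-identityˡ 0# ⟩
    0# ∎
    where
    rest : ∀ n → (Fin (suc (suc n)) → Fin (suc n) → Carrier) → Carrier
    rest n f = ∑ᶠ λ j → ∑ᶠ λ k → f (suc j) (suc k)

    rest≈0 : ∀ n (f : Fin (suc (suc n)) → Fin (suc n) → Carrier) →
      (∀ j k → f (punchIn j k) (pinch k j) + f j k ≈ 0#) → rest n f ≈ 0#
    rest≈0 zero    f cancel = ∑ᶠ-zero λ j → ∑ᶠ-zero λ ()
    rest≈0 (suc n) f cancel =
      ∑ᶠ-cancel n (λ j k → f (suc j) (suc k)) λ j k → cancel (suc j) (suc k)

  module _ (d : Fin (suc (suc n)) → Fin (suc n) → Carrier) where

    laplace₂ : (u v : Fin (suc (suc n)) → Carrier) →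
               Fin (suc (suc n)) → Fin (suc n) → Carrier
    laplace₂ u v j k = (sign j * sign k) * (u j * v (punchIn j k)) * d j k

    laplace₂-swap : (∀ j k → d (punchIn j k) (pinch k j) ≈ d j k) → ∀ u v j k →
      laplace₂ u v (punchIn j k) (pinch k j) + laplace₂ v u j k ≈ 0#
    laplace₂-swap d-sym u v j k = begin
      (sign j′ * sign k′) * (u j′ * v (punchIn j′ k′)) * d j′ k′ + laplace₂ v u j k
        ≈⟨ +-congʳ (*-cong (*-cong (sign-swap j k)
             (trans (*-congˡ (reflexive′ v (punchIn-pinch j k))) (*-comm _ _)))
             (d-sym j k)) ⟩
      - (sign j * sign k) * (v j * u j′) * d j k + laplace₂ v u j k
        ≈⟨ +-congʳ (trans (*-congʳ (sym (-‿distribˡ-* _ _))) (sym (-‿distribˡ-* _ _))) ⟩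
      - laplace₂ v u j k + laplace₂ v u j k
        ≈⟨ -‿inverseˡ _ ⟩
      0# ∎
      where
      j′ = punchIn j k
      k′ = pinch k j

  minor₂ : Matrix (suc (suc n)) → Fin (suc (suc n)) → Fin (suc n) → Carrier
  minor₂ M j k = Det λ i l → M (suc (suc i)) (punchIn j (punchIn k l))

  minor₂-sym : (M : Matrix (suc (suc n))) → ∀ j k →
               minor₂ M (punchIn j k) (pinch k j) ≈ minor₂ M j k
  minor₂-sym M j k = Det-cong λ i l → reflexive′ (M (suc (suc i))) (punchIn-punchIn j k l)

  Det-laplace₂ : (M : Matrix (suc (suc n))) →
    Det M ≈ ∑ᶠ λ j → ∑ᶠ (laplace₂ (minor₂ M) (M zero) (M (suc zero)) j)
  Det-laplace₂ M = trans (Det-suc M) (∑ᶠ-cong λ j →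
    trans (*-congˡ (Det-suc _)) (trans (∑ᶠ-*ˡ (sign j * M zero j) _) (∑ᶠ-cong λ k →
      solve 5 (λ s u t v d → (s :* u) :* (t :* v :* d) := (s :* t) :* (u :* v) :* d)
        refl (sign j) (M zero j) (sign k) (M (suc zero) (punchIn j k)) (minor₂ M j k))))

  Det-swap : (M N : Matrix (suc (suc n))) →
    (∀ j → M zero j ≈ N (suc zero) j) → (∀ j → M (suc zero) j ≈ N zero j) →
    (∀ i j → M (suc (suc i)) j ≈ N (suc (suc i)) j) → Det M + Det N ≈ 0#
  Det-swap {n} M N M₀≈N₁ M₁≈N₀ M≈N = begin
    Det M + Det N
      ≈⟨ +-cong (Det-laplace₂ M) (trans (Det-laplace₂ N) (∑ᶠ-cong λ j → ∑ᶠ-cong λ k →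
           *-cong (*-congˡ (*-cong (sym (M₁≈N₀ j)) (sym (M₀≈N₁ _))))
                  (Det-cong λ i l → sym (M≈N i _)))) ⟩
    ∑ᶠ (λ j → ∑ᶠ (F u v j)) + ∑ᶠ (λ j → ∑ᶠ (F v u j))
      ≈⟨ ∑ᶠ-+ (λ j → ∑ᶠ (F u v j)) _ ⟨
    ∑ᶠ (λ j → ∑ᶠ (F u v j) + ∑ᶠ (F v u j))
      ≈⟨ ∑ᶠ-cong (λ j → ∑ᶠ-+ (F u v j) (F v u j)) ⟨
    ∑ᶠ (λ j → ∑ᶠ λ k → F u v j k + F v u j k)
      ≈⟨ ∑ᶠ-cancel n _ (λ j k → trans (+-congˡ (+-comm _ _))
           (trans (+-interchange _ _ _ _)
             (trans (+-cong (step u v j k) (step v u j k)) (+-identityˡ 0#)))) ⟩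
    0# ∎
    where
    open ListSums K using (+-interchange)
    u = M zero
    v = M (suc zero)
    F = laplace₂ (minor₂ M)
    step = laplace₂-swap (minor₂ M) (minor₂-sym M)

  Det-equal-rows : (M : Matrix (suc (suc n))) →
    (∀ j → M zero j ≈ M (suc zero) j) → Det M ≈ 0#
  Det-equal-rows {n} M M₀≈M₁ = trans (Det-laplace₂ M) (∑ᶠ-cancel n _ λ j k →
    trans (+-congˡ (*-congʳ (*-congˡ (*-cong (M₀≈M₁ j) (sym (M₀≈M₁ _))))))
          (laplace₂-swap (minor₂ M) (minor₂-sym M) (M zero) (M (suc zero)) j k))

  -- `row i k` is the i-th row when the i-th entry of the vector is k. As each entry governs one
  -- row, the determinant is a function on vectors, and `deleteColumn` restores this form after an
  -- expansion.
  rowDet : (ℕ → ℕ → Fin n → Carrier) → Vec ℕ n → Carrier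
  rowDet row v = Det λ i → row (toℕ i) (Vec.lookup v i)

  deleteColumn : Fin (suc n) → (ℕ → ℕ → Fin (suc n) → Carrier) → ℕ → ℕ → Fin n → Carrier
  deleteColumn j row i k = row (suc i) k ∘ punchIn j

  rowDet-∷ : (row : ℕ → ℕ → Fin (suc n) → Carrier) → ∀ k v →
    rowDet row (k ∷ v) ≈ ∑ᶠ λ j → sign j * row 0 k j * rowDet (deleteColumn j row) v
  rowDet-∷ row k v = Det-suc _

  -- By `shift` a row depends on k - i alone, so `Swap` exchanges two adjacent rows. `Det-swap`
  -- treats the first two; an exchange further down passes to the minors.
  rowDet-alternating : (row : ℕ → ℕ → Fin n → Carrier) →
    (∀ i k j → row i k j ≈ row (suc i) (suc k) j) → Alternating (rowDet row)
  rowDet-alternating row shift = alternating (anti row shift) (dia row shift)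
    where
    anti : (row : ℕ → ℕ → Fin n → Carrier) →
      (∀ i k j → row i k j ≈ row (suc i) (suc k) j) →
      ∀ {v w} → Swap v w → rowDet row v + rowDet row w ≈ 0#
    anti row shift (here {k = k} {l} {v}) = Det-swap _ _
      (shift 0 k) (λ j → sym (shift 0 l j)) (λ _ _ → refl)
    anti row shift (there {k = k} {v} {w} s) =
      trans (+-cong (rowDet-∷ row k v) (rowDet-∷ row k w))
        (trans (sym (∑ᶠ-+ _ _)) (∑ᶠ-zero λ j → trans (sym (distribˡ _ _ _))
          (trans (*-congˡ (anti (deleteColumn j row) (λ i p → shift (suc i) p ∘ punchIn j) s))
                 (zeroʳ _))))

    dia : (row : ℕ → ℕ → Fin n → Carrier) →
      (∀ i k j → row i k j ≈ row (suc i) (suc k) j) →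
      ∀ {v} → Swap v v → rowDet row v ≈ 0#
    dia row shift (here {k = k}) = Det-equal-rows _ (shift 0 k)
    dia row shift (there {k = k} {v} s) = trans (rowDet-∷ row k v) (∑ᶠ-zero λ j →
      trans (*-congˡ (dia (deleteColumn j row) (λ i p → shift (suc i) p ∘ punchIn j) s))
            (zeroʳ _))

  Det-zero-row : (M : Matrix (suc n)) → (∀ j → M (fromℕ n) j ≈ 0#) → Det M ≈ 0#
  Det-zero-row {zero}  M zeros = trans (Det-suc M) (∑ᶠ-zero λ where
    zero → trans (*-congʳ (trans (*-congˡ (zeros zero)) (zeroʳ _))) (zeroˡ _))
  Det-zero-row {suc n} M zeros = trans (Det-suc M) (∑ᶠ-zero λ j →
    trans (*-congˡ (Det-zero-row _ λ k → zeros (punchIn j k))) (zeroʳ _))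

  -- Serves to drop a zero part from a Jacobi-Trudi determinant. As `det` expands along the first
  -- row, the last row is reached by induction through the minors.
  Det-unit-row : (M : Matrix (suc n)) →
    (∀ j → M (fromℕ n) (inject₁ j) ≈ 0#) → M (fromℕ n) (fromℕ n) ≈ 1# →
    Det M ≈ Det λ i j → M (inject₁ i) (inject₁ j)
  Det-unit-row {zero} M zeros one = trans (Det-suc M) (trans (∑ᶠ-suc _)
    (trans (+-cong (*-cong (trans (*-identityˡ _) one) (Det-zero _)) (∑ᶠ-zero λ ()))
      (trans (+-identityʳ _) (trans (*-identityʳ _) (sym (Det-zero _))))))
  Det-unit-row {suc n} M zeros one = trans (Det-suc M) (trans (∑ᶠ-last _) (trans
    (+-cong (∑ᶠ-cong λ j → *-cong
        (*-congʳ (reflexive (≡.cong ((- 1#) ^_) (Fin.toℕ-inject₁ j))))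
        (trans (Det-unit-row _
                 (λ k → trans (reflexive′ (M _) (punchIn-inject₁ j k)) (zeros _))
                 (trans (reflexive′ (M _) (punchIn-inject₁-fromℕ j)) one))
               (Det-cong λ i k → reflexive′ (M (suc (inject₁ i))) (punchIn-inject₁ j k))))
      -- Deleting the last column leaves a minor whose last row is zero.
      (trans (*-congˡ (Det-zero-row _ λ k →
          trans (reflexive′ (M _) (punchIn-fromℕ k)) (zeros k)))
        (zeroʳ _)))
    (trans (+-identityʳ _) (sym (Det-suc _)))))

-- Jacobi-Trudi determinants of partitions padded with zeros.

padTo : ∀ n → List ℕ → Vec ℕ n
padTo zero    _        = []
padTo (suc n) []       = 0 ∷ padTo n []
padTo (suc n) (k ∷ ks) = k ∷ padTo n ks

lookup-padTo-length : ∀ ks i → Vec.lookup (padTo (length ks) ks) i ≡ List.lookup ks i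
lookup-padTo-length (k ∷ ks) zero    = ≡.refl
lookup-padTo-length (k ∷ ks) (suc i) = lookup-padTo-length ks i

lookup-padTo-inject₁ : ∀ n ks i →
  Vec.lookup (padTo (suc n) ks) (inject₁ i) ≡ Vec.lookup (padTo n ks) i
lookup-padTo-inject₁ (suc n) []       zero    = ≡.refl
lookup-padTo-inject₁ (suc n) []       (suc i) = lookup-padTo-inject₁ n [] i
lookup-padTo-inject₁ (suc n) (k ∷ ks) zero    = ≡.refl
lookup-padTo-inject₁ (suc n) (k ∷ ks) (suc i) = lookup-padTo-inject₁ n ks i

lookup-padTo-fromℕ : ∀ n ks → length ks ≤ n → Vec.lookup (padTo (suc n) ks) (fromℕ n) ≡ 0
lookup-padTo-fromℕ zero    []       _         = ≡.refl
lookup-padTo-fromℕ (suc n) []       _         = lookup-padTo-fromℕ n [] z≤n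
lookup-padTo-fromℕ (suc n) (k ∷ ks) (s≤s k≤n) = lookup-padTo-fromℕ n ks k≤n

-- Bracketed as in `S`, so that the final identification with `S` holds by definition.
index : ℕ → ℕ → ℕ → ℤ
index i k j = (+ k ℤ.- + i) ℤ.+ + j

index-diagonal : ∀ i → index i 0 i ≡ + 0
index-diagonal i = ≡.trans (≡.cong (ℤ._+ + i) (ℤ.+-identityˡ (ℤ.- + i))) (ℤ.+-inverseˡ (+ i))

module JacobiTrudi {c ℓᴷ} (K : CommutativeRing c ℓᴷ) where
  open CommutativeRing K hiding (zero)
  open OverRing rawRing
  open Determinants K

  module _ (h : ℕ → Carrier) where

    jacobiTrudi : Vec ℕ n → Carrier
    jacobiTrudi = rowDet λ i k j → atℤ h (index i k (toℕ j))

    index-below : ∀ {i j} → j < i → atℤ h (index i 0 j) ≡ 0#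
    index-below {suc i} {j} (s≤s j≤i) = ≡.cong (atℤ h)
      (≡.trans (ℤ.⊖-< (s≤s j≤i)) (≡.cong (λ m → ℤ.- + m) (ℕ.+-∸-assoc 1 j≤i)))

    -- Counting rows from 0, a zero part in row n makes that row (h₋ₙ, ..., h₋₁, h₀) = (0, ..., 0,
    -- 1). The induction on `_≤′_` drops one such row at a time.
    jacobiTrudi-padTo : h 0 ≈ 1# → ∀ ks → length ks ℕ.≤′ n →
      jacobiTrudi (padTo n ks) ≈
      Det {length ks} λ i j → atℤ h (index (toℕ i) (List.lookup ks i) (toℕ j))
    jacobiTrudi-padTo h₀ ks ℕ.≤′-refl = Det-cong λ i j →
      reflexive (≡.cong (λ k → atℤ h (index (toℕ i) k (toℕ j))) (lookup-padTo-length ks i))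
    jacobiTrudi-padTo h₀ ks (ℕ.≤′-step {n} l≤n) = trans
      (Det-unit-row _
        (λ j → reflexive (≡.trans (≡.cong₂ (λ i k → atℤ h (index i k (toℕ (inject₁ j))))
                                           (Fin.toℕ-fromℕ n) last≡0)
          (≡.trans (≡.cong (λ m → atℤ h (index n 0 m)) (Fin.toℕ-inject₁ j))
                   (index-below (Fin.toℕ<n j)))))
        (trans (reflexive (≡.trans (≡.cong₂ (λ i k → atℤ h (index i k i))
                                            (Fin.toℕ-fromℕ n) last≡0)
          (≡.cong (atℤ h) (index-diagonal n)))) h₀))
      (trans (Det-cong λ i j → reflexive (≡.cong (atℤ h)
               (≡.trans (≡.cong₂ (λ i′ → index i′ (Vec.lookup (padTo (suc n) ks) (inject₁ i)))
                                 (Fin.toℕ-inject₁ i) (Fin.toℕ-inject₁ j))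
                        (≡.cong (λ k → index (toℕ i) k (toℕ j)) (lookup-padTo-inject₁ n ks i)))))
             (jacobiTrudi-padTo h₀ ks l≤n))
      where
      last≡0 = lookup-padTo-fromℕ n ks (ℕ.≤′⇒≤ l≤n)

-- Coefficients of power series and of their determinants.

≼⇒size≤ : (v w : Vec ℕ n) → v ≼ w → ∣ v ∣ ≤ ∣ w ∣
≼⇒size≤ []      []      _             = z≤n
≼⇒size≤ (k ∷ v) (l ∷ w) (k≤l , v≼w) = ℕ.+-mono-≤ k≤l (≼⇒size≤ v w v≼w)

shift-total : ∀ k {i a} → i ≤ a → ∀ m → (k ℕ.+ i) ℕ.+ (m ℕ.+ (a ℕ.∸ i)) ≡ (k ℕ.+ m) ℕ.+ a
shift-total k {i} {a} i≤a m = begin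
  (k ℕ.+ i) ℕ.+ (m ℕ.+ (a ℕ.∸ i)) ≡⟨ ℕ.+-assoc k i _ ⟩
  k ℕ.+ (i ℕ.+ (m ℕ.+ (a ℕ.∸ i))) ≡⟨ ≡.cong (k ℕ.+_) (ℕ.+-comm i _) ⟩
  k ℕ.+ (m ℕ.+ (a ℕ.∸ i) ℕ.+ i)   ≡⟨ ≡.cong (k ℕ.+_) (ℕ.+-assoc m _ i) ⟩
  k ℕ.+ (m ℕ.+ (a ℕ.∸ i ℕ.+ i))   ≡⟨ ≡.cong (λ d → k ℕ.+ (m ℕ.+ d)) (ℕ.m∸n+n≡m i≤a) ⟩
  k ℕ.+ (m ℕ.+ a)                 ≡⟨ ℕ.+-assoc k m a ⟨
  (k ℕ.+ m) ℕ.+ a                 ∎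
  where open ≡.≡-Reasoning

exceeds-total : ∀ k {a i m l} → a < i → m ≤ l → k ℕ.+ m ℕ.+ a < k ℕ.+ i ℕ.+ l
exceeds-total k {a} {i} {m} {l} a<i m≤l = begin-strict
  k ℕ.+ m ℕ.+ a   ≡⟨ ℕ.+-assoc k m a ⟩
  k ℕ.+ (m ℕ.+ a) <⟨ ℕ.+-monoʳ-< k (ℕ.+-mono-≤-< m≤l a<i) ⟩
  k ℕ.+ (l ℕ.+ i) ≡⟨ ≡.cong (k ℕ.+_) (ℕ.+-comm l i) ⟩
  k ℕ.+ (i ℕ.+ l) ≡⟨ ℕ.+-assoc k i l ⟨
  k ℕ.+ i ℕ.+ l   ∎
  where open ℕ.≤-Reasoning

module Coefficients {c ℓᴷ} (K : CommutativeRing c ℓᴷ) where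
  open CommutativeRing K hiding (zero)
  open SetoidReasoning setoid
  open ListSums K
  open Cancellation K
  open Determinants K
  open OverRing rawRing using (atℤ)
  module F = PowerSeries K
  open F using (FPS; 0ₚ; 1ₚ; x) renaming (_*_ to infixl 7 _✶_; _≈_ to infix 4 _≋_)
  module Fᵈ = RawSemiringDefinitions (RawRing.rawSemiring F.rawRing)
  module Kᵈ = RawSemiringDefinitions (RawRing.rawSemiring rawRing)

  -- The coefficient of x₁^a, as a series in the other variables, renumbered.
  head : FPS → ℕ → FPS
  head f a μ = f (a ∷ μ)

  ✶-∷ : ∀ f g a μ →
        (f ✶ g) (a ∷ μ) ≈ ∑[ i ∈ upTo (suc a) ] (head f i ✶ head g (a ℕ.∸ i)) μ
  ✶-∷ f g a μ = sum≈∑ (suc a) λ i → (head f i ✶ head g (a ℕ.∸ i)) μ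

  ✶-cong : ∀ {f f′ g g′} → f ≋ f′ → g ≋ g′ → f ✶ g ≋ f′ ✶ g′
  ✶-cong f≋f′ g≋g′ []      = *-cong (f≋f′ []) (g≋g′ [])
  ✶-cong {f} {f′} {g} {g′} f≋f′ g≋g′ (a ∷ μ) = trans (✶-∷ f g a μ)
    (trans (∑-cong (upTo (suc a)) λ i →
              ✶-cong (f≋f′ ∘ (i ∷_)) (g≋g′ ∘ (a ℕ.∸ i ∷_)) μ)
           (sym (✶-∷ f′ g′ a μ)))

  ✶-zeroˡ : ∀ {f g} → f ≋ 0ₚ → f ✶ g ≋ 0ₚ
  ✶-zeroˡ f≋0 []      = trans (*-congʳ (f≋0 [])) (zeroˡ _)
  ✶-zeroˡ {f} {g} f≋0 (a ∷ μ) = trans (✶-∷ f g a μ)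
    (∑-0 (upTo (suc a)) λ i → ✶-zeroˡ (f≋0 ∘ (i ∷_)) μ)

  ✶-zeroʳ : ∀ {f g} → g ≋ 0ₚ → f ✶ g ≋ 0ₚ
  ✶-zeroʳ g≋0 []      = trans (*-congˡ (g≋0 [])) (zeroʳ _)
  ✶-zeroʳ {f} {g} g≋0 (a ∷ μ) = trans (✶-∷ f g a μ)
    (∑-0 (upTo (suc a)) λ i → ✶-zeroʳ (g≋0 ∘ (a ℕ.∸ i ∷_)) μ)

  ✶-∑ : ∀ f (xs : List A) (g : A → FPS) μ →
        (f ✶ λ ν → ∑[ y ∈ xs ] g y ν) μ ≈ ∑[ y ∈ xs ] (f ✶ g y) μ
  ✶-∑ f xs g []      = sym (∑-*ˡ xs (f []) _)
  ✶-∑ f xs g (a ∷ μ) = begin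
    (f ✶ λ ν → ∑[ y ∈ xs ] g y ν) (a ∷ μ)
      ≈⟨ ✶-∷ f (λ ν → ∑[ y ∈ xs ] g y ν) a μ ⟩
    ∑[ i ∈ upTo (suc a) ] (head f i ✶ λ ν → ∑[ y ∈ xs ] g y (a ℕ.∸ i ∷ ν)) μ
      ≈⟨ ∑-cong (upTo (suc a)) (λ i → ✶-∑ (head f i) xs (λ y → head (g y) (a ℕ.∸ i)) μ) ⟩
    ∑[ i ∈ upTo (suc a) ] ∑[ y ∈ xs ] (head f i ✶ head (g y) (a ℕ.∸ i)) μ
      ≈⟨ ∑-swap (upTo (suc a)) xs _ ⟩
    ∑[ y ∈ xs ] ∑[ i ∈ upTo (suc a) ] (head f i ✶ head (g y) (a ℕ.∸ i)) μ
      ≈⟨ ∑-cong xs (λ y → ✶-∷ f (g y) a μ) ⟨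
    ∑[ y ∈ xs ] (f ✶ g y) (a ∷ μ) ∎

  ✶-[] : (p? : Dec P) → ∀ f g μ → (f ✶ λ ν → [ p? ] g ν) μ ≈ [ p? ] (f ✶ g) μ
  ✶-[] (yes _) f g μ = refl
  ✶-[] (no _)  f g μ = ✶-zeroʳ {f} (λ _ → refl) μ

  -- `f` does not involve x₁ and becomes `f₀` when the other variables are renumbered. Signs and
  -- powers of `x (suc r)` are of this kind, and multiplication by them commutes with extracting the
  -- coefficient of x₁^a.
  record ConstantIn₁ (f f₀ : FPS) : Set ℓᴷ where
    constructor constant
    field
      at-zero : head f 0 ≋ f₀
      at-suc  : ∀ a → head f (suc a) ≋ 0ₚ

  open ConstantIn₁

  constant-✶ : ∀ {f f₀} → ConstantIn₁ f f₀ → ∀ g a → head (f ✶ g) a ≋ f₀ ✶ head g a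
  constant-✶ {f} con g a μ = begin
    (f ✶ g) (a ∷ μ)
      ≈⟨ trans (✶-∷ f g a μ) (∑-upTo-suc a _) ⟩
    (head f 0 ✶ head g a) μ + (∑[ i ∈ upTo a ] (head f (suc i) ✶ head g (a ℕ.∸ suc i)) μ)
      ≈⟨ +-cong (✶-cong (at-zero con) (λ _ → refl) μ)
                (∑-0 (upTo a) λ i → ✶-zeroˡ (at-suc con i) μ) ⟩
    (_ ✶ head g a) μ + 0#
      ≈⟨ +-identityʳ _ ⟩
    (_ ✶ head g a) μ ∎

  ✶-constant : ∀ {f f₀ g g₀} → ConstantIn₁ f f₀ → ConstantIn₁ g g₀ →
               ConstantIn₁ (f ✶ g) (f₀ ✶ g₀)
  ✶-constant {g = g} con-f con-g = constant
    (λ μ → trans (constant-✶ con-f g 0 μ) (✶-cong (λ _ → refl) (at-zero con-g) μ))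
    (λ a μ → trans (constant-✶ con-f g (suc a) μ) (✶-zeroʳ (at-suc con-g a) μ))

  1ₚ-constant : ConstantIn₁ 1ₚ 1ₚ
  1ₚ-constant = constant (λ _ → refl) (λ _ _ → refl)

  ^-constant : ∀ {f f₀} → ConstantIn₁ f f₀ → ∀ i → ConstantIn₁ (f Fᵈ.^ i) (f₀ Fᵈ.^ i)
  ^-constant con zero    = 1ₚ-constant
  ^-constant con (suc i) = ✶-constant con (^-constant con i)

  ✶-identityˡ : ∀ g → 1ₚ ✶ g ≋ g
  ✶-identityˡ g []      = *-identityˡ _
  ✶-identityˡ g (a ∷ μ) = trans (constant-✶ 1ₚ-constant g a μ) (✶-identityˡ (head g a) μ)

  ✶-identityʳ : ∀ f → f ✶ 1ₚ ≋ f
  ✶-identityʳ f []      = *-identityʳ _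
  ✶-identityʳ f (a ∷ μ) = begin
    (f ✶ 1ₚ) (a ∷ μ)
      ≈⟨ ✶-∷ f 1ₚ a μ ⟩
    ∑[ i ∈ upTo (suc a) ] (head f i ✶ head 1ₚ (a ℕ.∸ i)) μ
      ≈⟨ ∑-cong-upTo (suc a) (λ i i<1+a → last-only i (s≤s⁻¹ i<1+a)) ⟩
    ∑[ i ∈ upTo (suc a) ] [ i ℕ.≟ a ] head f i μ
      ≈⟨ ∑-single (ℕ.n<1+n a) (λ i → head f i μ) ⟩
    f (a ∷ μ) ∎
    where
    last-only : ∀ i → i ≤ a → (head f i ✶ head 1ₚ (a ℕ.∸ i)) μ ≈ [ i ℕ.≟ a ] head f i μ
    last-only i i≤a with i ℕ.≟ a
    ... | yes ≡.refl rewrite ℕ.n∸n≡0 i = ✶-identityʳ (head f i) μ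
    ... | no i≢a with a ℕ.∸ i | ℕ.m<n⇒0<n∸m (ℕ.≤∧≢⇒< i≤a i≢a)
    ...   | suc _ | _ = ✶-zeroʳ {head f i} (λ _ → refl) μ

  sum-at : ∀ {n} (f : Fin n → FPS) μ → Fᵈ.sum f μ ≈ ∑ᶠ λ i → f i μ
  sum-at {zero}  f μ = sym (∑ᶠ-zero λ ())
  sum-at {suc n} f μ = trans (+-congˡ (sum-at (f ∘ suc) μ)) (sym (∑ᶠ-suc _))

  sum-at-upTo : ∀ n (f : ℕ → FPS) μ → Fᵈ.sum {n} (f ∘ toℕ) μ ≈ ∑[ i ∈ upTo n ] f i μ
  sum-at-upTo zero    f μ = refl
  sum-at-upTo (suc n) f μ = trans (+-congˡ (sum-at-upTo n (f ∘ suc) μ)) (sym (∑-upTo-suc n _))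

  ⊛-at : ∀ (f g : F.Series) m μ →
         (f F.⊛ g) m μ ≈ ∑[ i ∈ upTo (suc m) ] (f i ✶ g (m ℕ.∸ i)) μ
  ⊛-at f g m μ = sum-at-upTo (suc m) (λ i → f i ✶ g (m ℕ.∸ i)) μ

  x₀^-∷ : ∀ m a μ → (x 0 Fᵈ.^ m) (a ∷ μ) ≈ [ a ℕ.≟ m ] 1ₚ μ
  x₀^-∷ zero    zero    μ = refl
  x₀^-∷ zero    (suc a) μ = refl
  x₀^-∷ (suc m) zero    μ = trans (✶-∷ (x 0) (x 0 Fᵈ.^ m) 0 μ)
    (trans (+-identityʳ _) (✶-zeroˡ {g = head (x 0 Fᵈ.^ m) 0} (λ _ → refl) μ))
  x₀^-∷ (suc m) (suc a) μ = begin
    (x 0 ✶ X) (suc a ∷ μ)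
      ≈⟨ ✶-∷ (x 0) X (suc a) μ ⟩
    ∑[ i ∈ upTo (suc (suc a)) ] T i
      ≈⟨ trans (∑-upTo-suc (suc a) T) (+-congˡ (∑-upTo-suc a (T ∘ suc))) ⟩
    T 0 + (T 1 + (∑[ i ∈ upTo a ] T (suc (suc i))))
      ≈⟨ +-cong (✶-zeroˡ {g = head X (suc a)} (λ _ → refl) μ)
           (+-cong (✶-identityˡ (head X a) μ)
             (∑-0 (upTo a) λ i → ✶-zeroˡ {g = head X (a ℕ.∸ suc i)} (λ _ → refl) μ)) ⟩
    0# + (X (a ∷ μ) + 0#)
      ≈⟨ trans (+-identityˡ _) (+-identityʳ _) ⟩
    X (a ∷ μ)
      ≈⟨ x₀^-∷ m a μ ⟩
    [ a ℕ.≟ m ] 1ₚ μ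
      ≈⟨ []-cong (a ℕ.≟ m) (suc a ℕ.≟ suc m) (≡.cong suc) ℕ.suc-injective (λ _ → refl) ⟩
    [ suc a ℕ.≟ suc m ] 1ₚ μ ∎
    where
    X = x 0 Fᵈ.^ m
    T : ℕ → Carrier
    T i = (head (x 0) i ✶ head X (suc a ℕ.∸ i)) μ

  xSuc-constant : ∀ r → ConstantIn₁ (x (suc r)) (x r)
  xSuc-constant r = constant (λ _ → refl) (λ _ _ → refl)

  geometric : ℕ → F.Series
  geometric N = F.∏[ N ] λ r → F.1/[1- x r z]

  -- The term in w^m is the complete homogeneous function h_m, and the coefficient of x₁^a in
  -- h_m(x₁, x₂, ...) is h_{m-a}(x₂, ...). As `∏[_]` puts its last factor outermost, the induction
  -- removes the last variable, whose factor is constant in x₁, until only x₁ is left.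
  geometric-∷ : ∀ N m a μ →
    geometric (suc N) m (a ∷ μ) ≈ [ a ℕ.≤? m ] geometric N (m ℕ.∸ a) μ
  geometric-∷ zero m a μ = begin
    geometric 1 m (a ∷ μ)
      ≈⟨ ⊛-at F.1/[1- x 0 z] F.1ₛ m (a ∷ μ) ⟩
    ∑[ i ∈ upTo (suc m) ] (x 0 Fᵈ.^ i ✶ F.1ₛ (m ℕ.∸ i)) (a ∷ μ)
      ≈⟨ ∑-cong-upTo (suc m) (λ i i≤m → last-only i (s≤s⁻¹ i≤m)) ⟩
    ∑[ i ∈ upTo (suc m) ] [ i ℕ.≟ m ] (x 0 Fᵈ.^ i) (a ∷ μ)
      ≈⟨ ∑-single (ℕ.n<1+n m) (λ i → (x 0 Fᵈ.^ i) (a ∷ μ)) ⟩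
    (x 0 Fᵈ.^ m) (a ∷ μ)
      ≈⟨ x₀^-∷ m a μ ⟩
    [ a ℕ.≟ m ] 1ₚ μ
      ≈⟨ compare ⟩
    [ a ℕ.≤? m ] F.1ₛ (m ℕ.∸ a) μ ∎
    where
    last-only : ∀ i → i ≤ m → (x 0 Fᵈ.^ i ✶ F.1ₛ (m ℕ.∸ i)) (a ∷ μ) ≈
                              [ i ℕ.≟ m ] (x 0 Fᵈ.^ i) (a ∷ μ)
    last-only i i≤m with i ℕ.≟ m
    ... | yes ≡.refl rewrite ℕ.n∸n≡0 i = ✶-identityʳ (x 0 Fᵈ.^ i) (a ∷ μ)
    ... | no i≢m with m ℕ.∸ i | ℕ.m<n⇒0<n∸m (ℕ.≤∧≢⇒< i≤m i≢m)
    ...   | suc _ | _ = ✶-zeroʳ {x 0 Fᵈ.^ i} (λ _ → refl) (a ∷ μ)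

    compare : [ a ℕ.≟ m ] 1ₚ μ ≈ [ a ℕ.≤? m ] F.1ₛ (m ℕ.∸ a) μ
    compare with a ℕ.≟ m | a ℕ.≤? m
    ... | yes ≡.refl | yes _  rewrite ℕ.n∸n≡0 a = refl
    ... | yes ≡.refl | no a≰a = contradiction ℕ.≤-refl a≰a
    ... | no _       | no _   = refl
    ... | no a≢m     | yes a≤m with m ℕ.∸ a | ℕ.m<n⇒0<n∸m (ℕ.≤∧≢⇒< a≤m a≢m)
    ...   | suc _ | _ = refl
  geometric-∷ (suc N) m a μ = begin
    geometric (suc (suc N)) m (a ∷ μ)
      ≈⟨ ⊛-at F.1/[1- x (suc N) z] (geometric (suc N)) m (a ∷ μ) ⟩
    ∑[ i ∈ upTo (suc m) ] (x (suc N) Fᵈ.^ i ✶ geometric (suc N) (m ℕ.∸ i)) (a ∷ μ)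
      ≈⟨ ∑-cong (upTo (suc m)) step ⟩
    ∑[ i ∈ upTo (suc m) ] T i
      ≈⟨ truncate (a ℕ.≤? m) ⟩
    [ a ℕ.≤? m ] (∑[ i ∈ upTo (suc (m ℕ.∸ a)) ]
                    (x N Fᵈ.^ i ✶ geometric N (m ℕ.∸ a ℕ.∸ i)) μ)
      ≈⟨ []-congʳ (a ℕ.≤? m) (λ _ → ⊛-at F.1/[1- x N z] (geometric N) (m ℕ.∸ a) μ) ⟨
    [ a ℕ.≤? m ] geometric (suc N) (m ℕ.∸ a) μ ∎
    where
    T : ℕ → Carrier
    T i = [ a ℕ.≤? m ℕ.∸ i ] (x N Fᵈ.^ i ✶ geometric N (m ℕ.∸ i ℕ.∸ a)) μ

    step : ∀ i → (x (suc N) Fᵈ.^ i ✶ geometric (suc N) (m ℕ.∸ i)) (a ∷ μ) ≈ T i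
    step i = trans (constant-✶ (^-constant (xSuc-constant N) i) (geometric (suc N) (m ℕ.∸ i)) a μ)
      (trans (✶-cong {x N Fᵈ.^ i} (λ _ → refl) (geometric-∷ N (m ℕ.∸ i) a) μ)
             (✶-[] (a ℕ.≤? m ℕ.∸ i) (x N Fᵈ.^ i) (geometric N (m ℕ.∸ i ℕ.∸ a)) μ))

    -- If a ≤ m, the conditions a ≤ m ∸ i and i ≤ m ∸ a agree for all i ≤ m. If a > m every term
    -- vanishes, although i = 0 satisfies the second condition.
    truncate : (a≤?m : Dec (a ≤ m)) → ∑ (upTo (suc m)) T ≈
      [ a≤?m ] (∑[ i ∈ upTo (suc (m ℕ.∸ a)) ] (x N Fᵈ.^ i ✶ geometric N (m ℕ.∸ a ℕ.∸ i)) μ)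
    truncate (no a≰m)  = ∑-0 (upTo (suc m)) λ i → []-false (a ℕ.≤? m ℕ.∸ i)
      λ a≤m∸i → a≰m (ℕ.≤-trans a≤m∸i (ℕ.m∸n≤m m i))
    truncate (yes a≤m) = sym (trans
      (∑-cong-upTo (suc (m ℕ.∸ a)) λ i i≤m∸a → sym (trans
        ([]-true (a ℕ.≤? m ℕ.∸ i) (ℕ.m+n≤o⇒m≤o∸n a
          (ℕ.≤-trans (ℕ.+-monoʳ-≤ a (s≤s⁻¹ i≤m∸a)) (ℕ.≤-reflexive (ℕ.m+[n∸m]≡n a≤m)))))
        (reflexive (≡.cong (λ l → (x N Fᵈ.^ i ✶ geometric N l) μ)
          (≡.trans (ℕ.∸-+-assoc m i a)
            (≡.trans (≡.cong (m ℕ.∸_) (ℕ.+-comm i a)) (≡.sym (ℕ.∸-+-assoc m a i))))))))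
      (∑-upTo-extend (s≤s (ℕ.m∸n≤m m a)) λ i m∸a<i i≤m → []-false (a ℕ.≤? m ℕ.∸ i) λ a≤m∸i →
        ℕ.<⇒≱ m∸a<i (ℕ.m+n≤o⇒m≤o∸n i (ℕ.≤-trans (ℕ.+-monoʳ-≤ i a≤m∸i)
          (ℕ.≤-reflexive (ℕ.m+[n∸m]≡n (s≤s⁻¹ i≤m)))))))

  -- The complete homogeneous function h_m contains each monomial of degree m exactly once.
  ∏1/[1-xw]-at : ∀ m μ → F.∏1/[1-xw] m μ ≈ [ m ℕ.≟ size μ ] 1#
  ∏1/[1-xw]-at zero    []      = refl
  ∏1/[1-xw]-at (suc m) []      = refl
  ∏1/[1-xw]-at m       (a ∷ μ) = begin
    geometric (suc (length μ)) m (a ∷ μ)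
      ≈⟨ geometric-∷ (length μ) m a μ ⟩
    [ a ℕ.≤? m ] geometric (length μ) (m ℕ.∸ a) μ
      ≈⟨ []-congʳ (a ℕ.≤? m) (λ _ → ∏1/[1-xw]-at (m ℕ.∸ a) μ) ⟩
    [ a ℕ.≤? m ] [ m ℕ.∸ a ℕ.≟ size μ ] 1#
      ≈⟨ []-× (a ℕ.≤? m) (m ℕ.∸ a ℕ.≟ size μ) 1# ⟨
    [ (a ℕ.≤? m) ×-dec (m ℕ.∸ a ℕ.≟ size μ) ] 1#
      ≈⟨ []-cong ((a ℕ.≤? m) ×-dec (m ℕ.∸ a ℕ.≟ size μ)) (m ℕ.≟ a ℕ.+ size μ)
           (λ { (a≤m , eq) → ≡.trans (≡.sym (ℕ.m+[n∸m]≡n a≤m)) (≡.cong (a ℕ.+_) eq) })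
           (λ { ≡.refl → ℕ.m≤m+n a (size μ) , ℕ.m+n∸m≡n a (size μ) })
           (λ _ → refl) ⟩
    [ m ℕ.≟ a ℕ.+ size μ ] 1# ∎

  -- An arbitrary sequence `h` replaces `h̃`, so that the identity can be proved over any
  -- commutative ring; at `h̃` this unfolds to `symbol`.
  generalSymbol : (ℕ → Carrier) → ℤ → FPS
  generalSymbol h k = F.∑∞ λ m → atℤ h (k ℤ.+ + m) F.• F.∏1/[1-xw] m

  generalSymbol-at : ∀ h k μ → generalSymbol h k μ ≈ atℤ h (k ℤ.+ + size μ)
  generalSymbol-at h k μ = begin
    generalSymbol h k μ
      ≈⟨ sum≈∑ (suc (size μ)) (λ m → atℤ h (k ℤ.+ + m) * F.∏1/[1-xw] m μ) ⟩
    ∑[ m ∈ upTo (suc (size μ)) ] (atℤ h (k ℤ.+ + m) * F.∏1/[1-xw] m μ)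
      ≈⟨ ∑-cong (upTo (suc (size μ))) (λ m →
           trans (*-congˡ (∏1/[1-xw]-at m μ))
             (trans (sym ([]-* (m ℕ.≟ size μ) _ 1#))
               ([]-congʳ (m ℕ.≟ size μ) λ _ → *-identityʳ _))) ⟩
    ∑[ m ∈ upTo (suc (size μ)) ] [ m ℕ.≟ size μ ] atℤ h (k ℤ.+ + m)
      ≈⟨ ∑-single (ℕ.n<1+n (size μ)) (λ m → atℤ h (k ℤ.+ + m)) ⟩
    atℤ h (k ℤ.+ + size μ) ∎

  signₚ : Fin n → FPS
  signₚ j = (F.- 1ₚ) Fᵈ.^ toℕ j

  -0≈0 : - 0# ≈ 0#
  -0≈0 = trans (sym (+-identityʳ _)) (-‿inverseˡ 0#)

  signₚ-constant : (j : Fin n) → ConstantIn₁ (signₚ j) (signₚ j)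
  signₚ-constant j = ^-constant (constant (λ _ → refl) λ _ _ → -0≈0) (toℕ j)

  Row : ℕ → Set c
  Row n = ℕ → ℕ → Fin n → FPS

  deleteColumnₚ : Fin (suc n) → Row (suc n) → Row n
  deleteColumnₚ j row i k = row (suc i) k ∘ punchIn j

  opaque
    rowDetₚ : Row n → Vec ℕ n → FPS
    rowDetₚ row v = F.det λ i → row (toℕ i) (Vec.lookup v i)

    rowDetₚ≡det : (row : Row n) → ∀ v →
                  rowDetₚ row v ≡ F.det λ i → row (toℕ i) (Vec.lookup v i)
    rowDetₚ≡det row v = ≡.refl

    rowDetₚ-zero : (row : Row 0) → rowDetₚ row [] ≡ 1ₚ
    rowDetₚ-zero row = ≡.refl

    rowDetₚ-∷ : (row : Row (suc n)) → ∀ k v μ → rowDetₚ row (k ∷ v) μ ≈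
      ∑ᶠ λ j → (signₚ j ✶ row 0 k j ✶ rowDetₚ (deleteColumnₚ j row) v) μ
    rowDetₚ-∷ row k v μ =
      sum-at (λ j → signₚ j ✶ row 0 k j ✶ rowDetₚ (deleteColumnₚ j row) v) μ

  detₚ-cong : {M N : F.Matrix n} → (∀ i j → M i j ≋ N i j) → F.det M ≋ F.det N
  detₚ-cong {zero}  M≋N μ = refl
  detₚ-cong {suc n} {M} {N} M≋N μ =
    trans (sum-at (cofactor M) μ) (trans (∑ᶠ-cong λ j → ✶-cong
      (✶-cong {signₚ j} (λ _ → refl) (M≋N zero j))
      (detₚ-cong λ i k → M≋N (suc i) (punchIn j k)) μ)
    (sym (sum-at (cofactor N) μ)))
    where
    cofactor : F.Matrix (suc n) → Fin (suc n) → FPS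
    cofactor M j = signₚ j ✶ M zero j ✶ F.det λ i k → M (suc i) (punchIn j k)

  ^-at-[] : ∀ f i → (f Fᵈ.^ i) [] ≈ f [] Kᵈ.^ i
  ^-at-[] f zero    = refl
  ^-at-[] f (suc i) = *-congˡ (^-at-[] f i)

  -- Taking the constant term respects sums and products, hence determinants. This makes Φ_∅ a
  -- determinant over `K`, to which `rowDet-alternating` applies.
  rowDetₚ-[] : (row : Row n) → ∀ v →
               rowDetₚ row v [] ≈ rowDet (λ i k j → row i k j []) v
  rowDetₚ-[] row []      =
    trans (reflexive (≡.cong (_$ []) (rowDetₚ-zero row))) (sym (Det-zero _))
  rowDetₚ-[] row (k ∷ v) = trans (rowDetₚ-∷ row k v []) (trans
    (∑ᶠ-cong λ j → *-cong (*-congʳ {row 0 k j []} (^-at-[] (F.- 1ₚ) (toℕ j)))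
                          (rowDetₚ-[] (deleteColumnₚ j row) v))
    (sym (rowDet-∷ (λ i k j → row i k j []) k v)))

  ∑ᶠ-∑ : (xs : List A) (f : Fin n → A → Carrier) →
         ∑ᶠ (λ j → ∑[ y ∈ xs ] f j y) ≈ ∑[ y ∈ xs ] ∑ᶠ λ j → f j y
  ∑ᶠ-∑ []       f = ∑ᶠ-zero λ _ → refl
  ∑ᶠ-∑ (y ∷ xs) f = trans (∑ᶠ-+ _ _) (+-congˡ (∑ᶠ-∑ xs f))

  ∑ᶠ-[] : (p? : Dec P) (f : Fin n → Carrier) → ∑ᶠ (λ j → [ p? ] f j) ≈ [ p? ] ∑ᶠ f
  ∑ᶠ-[] (yes _) f = refl
  ∑ᶠ-[] (no _)  f = ∑ᶠ-zero λ _ → refl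

  ofSize : ℕ → (Vec ℕ n → Carrier) → Vec ℕ n → Carrier
  ofSize m Φ w = [ ∣ w ∣ ℕ.≟ m ] Φ w

  -- By multilinearity in the rows.
  rowDetₚ-expand : (row : Row n) → (∀ i k j a μ → row i k j (a ∷ μ) ≈ row i (k ℕ.+ a) j μ) →
    ∀ v a b → ∣ v ∣ ℕ.+ a < b → ∀ μ →
    rowDetₚ row v (a ∷ μ) ≈ above b (ofSize (∣ v ∣ ℕ.+ a) λ w → rowDetₚ row w μ) v
  rowDetₚ-expand row shift [] a b _ μ = trans
    (reflexive (≡.cong (_$ (a ∷ μ)) (rowDetₚ-zero row)))
    (trans (one a) (sym (trans (+-identityʳ _) ([]-congʳ (0 ℕ.≟ a) λ _ →
      reflexive (≡.cong (_$ μ) (rowDetₚ-zero row))))))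
    where
    one : ∀ a → 1ₚ (a ∷ μ) ≈ [ 0 ℕ.≟ a ] 1ₚ μ
    one zero    = refl
    one (suc _) = refl
  rowDetₚ-expand {suc n} row shift (k ∷ v) a b <b μ = begin
    rowDetₚ row (k ∷ v) (a ∷ μ)
      ≈⟨ rowDetₚ-∷ row k v (a ∷ μ) ⟩
    ∑ᶠ (λ j → (signₚ j ✶ row 0 k j ✶ rowDetₚ (deleteColumnₚ j row) v) (a ∷ μ))
      -- Row 0 takes x₁^i, which raises its entry to k + i, and the induction hypothesis distributes
      -- the remaining exponent a ∸ i over the other rows.
      ≈⟨ ∑ᶠ-cong term ⟩
    ∑ᶠ (λ j → ∑[ i ∈ upTo (suc a) ] above (suc b) (ofSize (∣ v ∣ ℕ.+ (a ℕ.∸ i)) (C j i)) v)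
      ≈⟨ ∑ᶠ-∑ (upTo (suc a)) _ ⟩
    ∑[ i ∈ upTo (suc a) ] ∑ᶠ (λ j → above (suc b) (ofSize (∣ v ∣ ℕ.+ (a ℕ.∸ i)) (C j i)) v)
      ≈⟨ ∑-cong-upTo (suc a) (λ i i≤a → collect i (s≤s⁻¹ i≤a)) ⟩
    ∑[ i ∈ upTo (suc a) ] T (k ℕ.+ i)
      -- For i > a no w ≥ v satisfies k + i + |w| = k + |v| + a, so the range can be enlarged to
      -- that of the box.
      ≈⟨ ∑-upTo-extend a<b∸k (λ i a<i _ → ∑-0 (box (suc b) n) λ w →
           []-zero (v ≼? w) λ v≼w →
             []-false (k ℕ.+ i ℕ.+ ∣ w ∣ ℕ.≟ ∣ k ∷ v ∣ ℕ.+ a)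
               (ℕ.>⇒≢ (exceeds-total k a<i (≼⇒size≤ v w v≼w)))) ⟩
    ∑[ i ∈ upTo (b ℕ.∸ k) ] T (k ℕ.+ i)
      ≈⟨ ∑-upTo-shift k (ℕ.<⇒≤ (ℕ.≤-<-trans (ℕ.m≤m+n k a) k+a<b)) T ⟨
    ∑[ l ∈ upTo b ] [ k ℕ.≤? l ] T l
      ≈⟨ above-∷ b _ k v ⟨
    above b (ofSize (∣ k ∷ v ∣ ℕ.+ a) λ w → rowDetₚ row w μ) (k ∷ v) ∎
    where
    T : ℕ → Carrier
    T l = above (suc b) (λ w → ofSize (∣ k ∷ v ∣ ℕ.+ a) (λ w → rowDetₚ row w μ) (l ∷ w)) v

    C : Fin (suc n) → ℕ → Vec ℕ n → Carrier
    C j i w = (signₚ j ✶ row 0 (k ℕ.+ i) j ✶ rowDetₚ (deleteColumnₚ j row) w) μ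

    k+a<b : k ℕ.+ a < b
    k+a<b = ℕ.≤-<-trans (ℕ.+-monoˡ-≤ a (ℕ.m≤m+n k ∣ v ∣)) <b

    a<b∸k : a < b ℕ.∸ k
    a<b∸k = ℕ.m+n≤o⇒m≤o∸n (suc a) (≡.subst (_< b) (ℕ.+-comm k a) k+a<b)

    v+<b : ∀ i → ∣ v ∣ ℕ.+ (a ℕ.∸ i) < suc b
    v+<b i = s≤s (ℕ.≤-trans (ℕ.+-mono-≤ (ℕ.m≤n+m ∣ v ∣ k) (ℕ.m∸n≤m a i)) (ℕ.<⇒≤ <b))

    term : ∀ j → (signₚ j ✶ row 0 k j ✶ rowDetₚ (deleteColumnₚ j row) v) (a ∷ μ) ≈
      ∑[ i ∈ upTo (suc a) ] above (suc b) (ofSize (∣ v ∣ ℕ.+ (a ℕ.∸ i)) (C j i)) v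
    term j = trans (✶-∷ (signₚ j ✶ row 0 k j) (rowDetₚ (deleteColumnₚ j row) v) a μ)
      (∑-cong (upTo (suc a)) λ i → trans
      (✶-cong
        (λ ν → trans (constant-✶ (signₚ-constant j) (row 0 k j) i ν)
                     (✶-cong {signₚ j} (λ _ → refl) (shift 0 k j i) ν))
        (rowDetₚ-expand (deleteColumnₚ j row) (λ i k → shift (suc i) k ∘ punchIn j)
          v (a ℕ.∸ i) (suc b) (v+<b i))
        μ)
      (trans (✶-∑ _ (box (suc b) n) _ μ) (∑-cong (box (suc b) n) λ w →
        trans (✶-[] (v ≼? w) _ _ μ) ([]-congʳ (v ≼? w) λ _ →
          ✶-[] (∣ w ∣ ℕ.≟ ∣ v ∣ ℕ.+ (a ℕ.∸ i)) _ _ μ))))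

    collect : ∀ i → i ≤ a →
      ∑ᶠ (λ j → above (suc b) (ofSize (∣ v ∣ ℕ.+ (a ℕ.∸ i)) (C j i)) v) ≈ T (k ℕ.+ i)
    collect i i≤a = trans (∑ᶠ-∑ (box (suc b) n) _) (∑-cong (box (suc b) n) λ w →
      trans (∑ᶠ-[] (v ≼? w) _) ([]-congʳ (v ≼? w) λ _ →
        trans (∑ᶠ-[] (∣ w ∣ ℕ.≟ ∣ v ∣ ℕ.+ (a ℕ.∸ i)) _)
          ([]-cong (∣ w ∣ ℕ.≟ ∣ v ∣ ℕ.+ (a ℕ.∸ i)) (k ℕ.+ i ℕ.+ ∣ w ∣ ℕ.≟ ∣ k ∷ v ∣ ℕ.+ a)
            (λ eq → ≡.trans (≡.cong (k ℕ.+ i ℕ.+_) eq) (shift-total k i≤a ∣ v ∣))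
            (λ eq → ℕ.+-cancelˡ-≡ (k ℕ.+ i) _ _ (≡.trans eq (≡.sym (shift-total k i≤a ∣ v ∣))))
            λ _ → sym (rowDetₚ-∷ row (k ℕ.+ i) w μ))))

-- Semistandard tableaux and Kostka numbers.

strip⇒≼ : (v w : Vec ℕ n) → Strip v w → v ≼ w
strip⇒≼ []      []      _                  = tt
strip⇒≼ (k ∷ v) (l ∷ w) (k≤l , _ , strip) = k≤l , strip⇒≼ v w strip

zeros : ∀ n → Vec ℕ n
zeros n = Vec.replicate n 0

size-zeros : ∀ n → ∣ zeros n ∣ ≡ 0
size-zeros zero    = ≡.refl
size-zeros (suc n) = size-zeros n

zeros-decreasing : ∀ n → Decreasing (zeros n)
zeros-decreasing zero          = tt
zeros-decreasing (suc zero)    = z≤n , tt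
zeros-decreasing (suc (suc n)) = z≤n , zeros-decreasing (suc n)

InBox : ℕ → Vec ℕ n → Set
InBox b []      = ⊤
InBox b (k ∷ v) = k < b × InBox (suc b) v

contentFrom : ℕ → List Shape → List ℕ
contentFrom m []      = []
contentFrom m (σ ∷ T) = (size σ ℕ.∸ m) ∷ contentFrom (size σ) T

tail′ : List ℕ → List ℕ
tail′ []      = []
tail′ (_ ∷ μ) = μ

-- The local helper of content is only accessible through such a tail.
content-∷ : ∀ σ T → tail′ (content (σ ∷ T)) ≡ contentFrom (size σ) T
content-∷ σ []      = ≡.refl
content-∷ σ (τ ∷ T) = ≡.cong (size τ ℕ.∸ size σ ∷_) (content-∷ τ T)

content≡contentFrom : ∀ T → content T ≡ contentFrom 0 T
content≡contentFrom []      = ≡.refl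
content≡contentFrom (σ ∷ T) = ≡.cong (size σ ∷_) (content-∷ σ T)

-- The size from which the content entry of a shape appended to the list is counted.
lastSize : ℕ → List Shape → ℕ
lastSize m []      = m
lastSize m (σ ∷ T) = lastSize (size σ) T

lastSize-∷ʳ : ∀ m T σ → lastSize m (T ∷ʳ σ) ≡ size σ
lastSize-∷ʳ m []      σ = ≡.refl
lastSize-∷ʳ m (τ ∷ T) σ = lastSize-∷ʳ (size τ) T σ

contentFrom-∷ʳ : ∀ m T σ →
  contentFrom m (T ∷ʳ σ) ≡ contentFrom m T ∷ʳ (size σ ℕ.∸ lastSize m T)
contentFrom-∷ʳ m []      σ = ≡.refl
contentFrom-∷ʳ m (τ ∷ T) σ = ≡.cong (size τ ℕ.∸ m ∷_) (contentFrom-∷ʳ (size τ) T σ)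

tableaux-lastSize : ∀ N λ′ → All (λ T → lastSize 0 T ≡ size λ′) (tableaux N λ′)
tableaux-lastSize zero    λ′ with size λ′
... | zero  = ≡.refl ∷ []
... | suc _ = []
tableaux-lastSize (suc N) λ′ = All.concat⁺ (All.map⁺ (All.universal
  (λ ν → All.map⁺ (All.universal (λ T → lastSize-∷ʳ 0 T λ′) (tableaux N ν)))
  (removeStrip λ′)))

content-∷ʳ : ∀ T σ {m} → lastSize 0 T ≡ m →
             content (T ∷ʳ σ) ≡ content T ∷ʳ (size σ ℕ.∸ m)
content-∷ʳ T σ ≡.refl = begin
  content (T ∷ʳ σ)                              ≡⟨ content≡contentFrom (T ∷ʳ σ) ⟩
  contentFrom 0 (T ∷ʳ σ)                        ≡⟨ contentFrom-∷ʳ 0 T σ ⟩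
  contentFrom 0 T ∷ʳ (size σ ℕ.∸ lastSize 0 T)
    ≡⟨ ≡.cong (_∷ʳ (size σ ℕ.∸ lastSize 0 T)) (content≡contentFrom T) ⟨
  content T ∷ʳ (size σ ℕ.∸ lastSize 0 T)        ∎
  where open ≡.≡-Reasoning

infixr 5 _⁺⁺_
_⁺⁺_ : Shape → ℕ → Shape
λ′ ⁺⁺ k = λ′ ++ List.replicate k 0

firstPart-⁺⁺ : ∀ λ′ k → firstPart (λ′ ⁺⁺ k) ≡ firstPart λ′
firstPart-⁺⁺ []       zero    = ≡.refl
firstPart-⁺⁺ []       (suc k) = ≡.refl
firstPart-⁺⁺ (a ∷ λ′) k       = ≡.refl

size-⁺⁺ : ∀ λ′ k → size (λ′ ⁺⁺ k) ≡ size λ′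
size-⁺⁺ []       zero    = ≡.refl
size-⁺⁺ []       (suc k) = size-⁺⁺ [] k
size-⁺⁺ (a ∷ λ′) k       = ≡.cong (a ℕ.+_) (size-⁺⁺ λ′ k)

removeStrip-zeros : ∀ k → removeStrip (List.replicate k 0) ≡ List.replicate k 0 ∷ []
removeStrip-zeros zero          = ≡.refl
removeStrip-zeros (suc zero)    = ≡.refl
removeStrip-zeros (suc (suc k)) rewrite removeStrip-zeros (suc k) = ≡.refl

module Tableaux {c ℓᴷ} (K : CommutativeRing c ℓᴷ) where
  open CommutativeRing K hiding (zero)
  open RawSemiringDefinitions (RawRing.rawSemiring rawRing) using () renaming (_×_ to _×ℕ_)
  open SetoidReasoning setoid
  open ListSums K
  open Cancellation K
  open Coefficients K using (ofSize)

  ∑-one : (xs : List A) → ∑ xs (λ _ → 1#) ≈ length xs ×ℕ 1#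
  ∑-one []       = refl
  ∑-one (x ∷ xs) = +-congˡ (∑-one xs)

  ∑-concatMap : (g : A → List B) (xs : List A) (f : B → Carrier) →
                ∑ (List.concatMap g xs) f ≈ ∑[ y ∈ xs ] ∑ (g y) f
  ∑-concatMap g []       f = refl
  ∑-concatMap g (y ∷ xs) f = trans (∑-++ (g y) _ f) (+-congˡ (∑-concatMap g xs f))

  ∑-cong-All : {xs : List A} {f g : A → Carrier} →
               All (λ y → f y ≈ g y) xs → ∑ xs f ≈ ∑ xs g
  ∑-cong-All []       = refl
  ∑-cong-All (p ∷ ps) = +-cong p (∑-cong-All ps)

  _≟ₗ_ : (μ ν : List ℕ) → Dec (μ ≡ ν)
  _≟ₗ_ = List.≡-dec ℕ._≟_

  number : Shape → List ℕ → Carrier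
  number λ′ μ = ∑[ T ∈ tableaux (length μ) λ′ ] [ content T ≟ₗ μ ] 1#

  number≈kostka : ∀ λ′ μ → number (parts λ′) μ ≈ kostka λ′ μ ×ℕ 1#
  number≈kostka λ′ μ = trans (sym (∑-filter (λ T → content T ≟ₗ μ) 𝒯 λ _ → 1#))
    (∑-one (List.filter (λ T → content T ≟ₗ μ) 𝒯))
    where 𝒯 = tableaux (length μ) (parts λ′)

  number-[] : ∀ λ′ → number λ′ [] ≈ [ size λ′ ℕ.≟ 0 ] 1#
  number-[] λ′ with size λ′
  ... | zero  = +-identityʳ 1#
  ... | suc _ = refl

  -- Branching rule: deleting the boxes with the largest entry leaves a tableau of shape ν, and the
  -- number of these boxes is the last entry of the content.
  number-∷ʳ : ∀ λ′ μ m → number λ′ (μ ∷ʳ m) ≈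
    ∑[ ν ∈ removeStrip λ′ ] [ size λ′ ℕ.∸ size ν ℕ.≟ m ] number ν μ
  number-∷ʳ λ′ μ m = begin
    number λ′ (μ ∷ʳ m)
      ≈⟨ reflexive (≡.cong (λ N → ∑ (tableaux N λ′) matches)
           (≡.trans (List.length-++ μ) (ℕ.+-comm (length μ) 1))) ⟩
    ∑ (tableaux (suc (length μ)) λ′) matches
      ≈⟨ ∑-concatMap (λ ν → List.map (_∷ʳ λ′) (tableaux (length μ) ν)) (removeStrip λ′) matches ⟩
    ∑[ ν ∈ removeStrip λ′ ] ∑ (List.map (_∷ʳ λ′) (tableaux (length μ) ν)) matches
      ≈⟨ ∑-cong (removeStrip λ′) (λ ν → trans
           (∑-map (_∷ʳ λ′) (tableaux (length μ) ν) matches)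
           (trans (∑-cong-All (All.map (λ {T} → split ν T) (tableaux-lastSize (length μ) ν)))
                  (∑-[] (size λ′ ℕ.∸ size ν ℕ.≟ m) (tableaux (length μ) ν) _))) ⟩
    ∑[ ν ∈ removeStrip λ′ ] [ size λ′ ℕ.∸ size ν ℕ.≟ m ] number ν μ ∎
    where
    matches : List Shape → Carrier
    matches T = [ content T ≟ₗ (μ ∷ʳ m) ] 1#

    split : ∀ ν T → lastSize 0 T ≡ size ν →
      matches (T ∷ʳ λ′) ≈ [ size λ′ ℕ.∸ size ν ℕ.≟ m ] [ content T ≟ₗ μ ] 1#
    split ν T last≡ = trans
      ([]-cong (content (T ∷ʳ λ′) ≟ₗ (μ ∷ʳ m))
               ((size λ′ ℕ.∸ size ν ℕ.≟ m) ×-dec (content T ≟ₗ μ))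
        (λ eq → let μ≡ , m≡ = List.∷ʳ-injective (content T) μ
                                (≡.trans (≡.sym (content-∷ʳ T λ′ last≡)) eq)
                in m≡ , μ≡)
        (λ { (m≡ , μ≡) → ≡.trans (content-∷ʳ T λ′ last≡) (≡.cong₂ _∷ʳ_ μ≡ m≡) })
        (λ _ → refl))
      ([]-× (size λ′ ℕ.∸ size ν ℕ.≟ m) (content T ≟ₗ μ) 1#)

  removeStrip-⁺⁺ : ∀ λ′ k (g : Shape → Carrier) →
    ∑ (removeStrip (λ′ ⁺⁺ k)) g ≈ ∑[ ν ∈ removeStrip λ′ ] g (ν ⁺⁺ k)
  removeStrip-⁺⁺ []       k g =
    reflexive (≡.cong (λ xs → ∑ xs g) (removeStrip-zeros k))
  removeStrip-⁺⁺ (a ∷ λ′) k g = begin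
    ∑ (removeStrip (a ∷ λ′ ⁺⁺ k)) g
      ≈⟨ ∑-product _∷_ (firsts (firstPart (λ′ ⁺⁺ k))) (removeStrip (λ′ ⁺⁺ k)) g ⟩
    ∑[ i ∈ firsts (firstPart (λ′ ⁺⁺ k)) ] ∑[ ν ∈ removeStrip (λ′ ⁺⁺ k) ] g (i ∷ ν)
      ≈⟨ reflexive (≡.cong (λ f → ∑[ i ∈ firsts f ] ∑[ ν ∈ removeStrip (λ′ ⁺⁺ k) ] g (i ∷ ν))
                           (firstPart-⁺⁺ λ′ k)) ⟩
    ∑[ i ∈ firsts (firstPart λ′) ] ∑[ ν ∈ removeStrip (λ′ ⁺⁺ k) ] g (i ∷ ν)
      ≈⟨ ∑-cong (firsts (firstPart λ′)) (λ i → removeStrip-⁺⁺ λ′ k (g ∘ (i ∷_))) ⟩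
    ∑[ i ∈ firsts (firstPart λ′) ] ∑[ ν ∈ removeStrip λ′ ] g (i ∷ ν ⁺⁺ k)
      ≈⟨ ∑-product _∷_ (firsts (firstPart λ′)) (removeStrip λ′) (λ ν → g (ν ⁺⁺ k)) ⟨
    ∑[ ν ∈ removeStrip (a ∷ λ′) ] g (ν ⁺⁺ k) ∎
    where
    firsts : ℕ → List ℕ
    firsts f = List.filter (f ℕ.≤?_) (upTo (suc a))

  -- Removing a strip leaves trailing zeros in place. The induction runs from the end of μ because
  -- `tableaux` removes the largest entry first.
  number-⁺⁺ : ∀ {μ} → Reverse μ → ∀ λ′ k → number (λ′ ⁺⁺ k) μ ≈ number λ′ μ
  number-⁺⁺ []             λ′ k = trans (number-[] (λ′ ⁺⁺ k))
    (trans (reflexive (≡.cong (λ m → [ m ℕ.≟ 0 ] 1#) (size-⁺⁺ λ′ k))) (sym (number-[] λ′)))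
  number-⁺⁺ (μ ∶ rev ∶ʳ m) λ′ k = begin
    number (λ′ ⁺⁺ k) (μ ∷ʳ m)
      ≈⟨ number-∷ʳ (λ′ ⁺⁺ k) μ m ⟩
    ∑[ ν ∈ removeStrip (λ′ ⁺⁺ k) ] [ size (λ′ ⁺⁺ k) ℕ.∸ size ν ℕ.≟ m ] number ν μ
      ≈⟨ removeStrip-⁺⁺ λ′ k _ ⟩
    ∑[ ν ∈ removeStrip λ′ ] [ size (λ′ ⁺⁺ k) ℕ.∸ size (ν ⁺⁺ k) ℕ.≟ m ] number (ν ⁺⁺ k) μ
      ≈⟨ ∑-cong (removeStrip λ′) (λ ν → trans
           (reflexive (≡.cong₂ (λ s t → [ s ℕ.∸ t ℕ.≟ m ] number (ν ⁺⁺ k) μ)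
                               (size-⁺⁺ λ′ k) (size-⁺⁺ ν k)))
           ([]-congʳ (size λ′ ℕ.∸ size ν ℕ.≟ m) λ _ → number-⁺⁺ rev ν k)) ⟩
    ∑[ ν ∈ removeStrip λ′ ] [ size λ′ ℕ.∸ size ν ℕ.≟ m ] number ν μ
      ≈⟨ number-∷ʳ λ′ μ m ⟨
    number λ′ (μ ∷ʳ m) ∎

  ∑-cong-box : ∀ b n {f g : Vec ℕ n → Carrier} → (∀ v → InBox b v → f v ≈ g v) →
               ∑ (box b n) f ≈ ∑ (box b n) g
  ∑-cong-box b zero    f≈g = +-congʳ (f≈g [] tt)
  ∑-cong-box b (suc n) f≈g = trans (∑-box b n _) (trans
    (∑-cong-upTo b λ k k<b → ∑-cong-box (suc b) n λ v v∈ → f≈g (k ∷ v) (k<b , v∈))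
    (sym (∑-box b n _)))

  -- A vector entrywise below `w` lies in every box that contains `w`, so the box misses none of the
  -- listed shapes.
  removeStrip-box : ∀ b (w : Vec ℕ n) → InBox b w → ∀ g →
    ∑ (removeStrip (toList w)) g ≈ ∑[ v ∈ box b n ] [ strip? v w ] g (toList v)
  removeStrip-box b []      _           g = refl
  removeStrip-box {suc n} b (k ∷ w) (k<b , w∈) g = begin
    ∑ (removeStrip (k ∷ toList w)) g
      ≈⟨ trans (∑-product _∷_ (List.filter (first w ℕ.≤?_) (upTo (suc k))) (removeStrip (toList w)) g)
               (∑-filter (first w ℕ.≤?_) (upTo (suc k)) _) ⟩
    ∑[ i ∈ upTo (suc k) ] [ first w ℕ.≤? i ] (∑[ ν ∈ removeStrip (toList w) ] g (i ∷ ν))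
      ≈⟨ ∑-cong-upTo (suc k) (λ i i≤k → trans
           ([]-congʳ (first w ℕ.≤? i) λ _ → removeStrip-box (suc b) w w∈ (g ∘ (i ∷_)))
           (sym ([]-true (i ℕ.≤? k) (s≤s⁻¹ i≤k)))) ⟩
    ∑[ i ∈ upTo (suc k) ] T i
      ≈⟨ ∑-upTo-extend k<b (λ i k<i _ → []-false (i ℕ.≤? k) (ℕ.<⇒≱ k<i)) ⟩
    ∑[ i ∈ upTo b ] T i
      ≈⟨ ∑-cong (upTo b) (λ i → trans
           (trans ([]-congʳ (i ℕ.≤? k) λ _ → sym (∑-[] (first w ℕ.≤? i) (box (suc b) n) _))
                  (sym (∑-[] (i ℕ.≤? k) (box (suc b) n) _)))
           (∑-cong (box (suc b) n) λ v → trans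
             ([]-congʳ (i ℕ.≤? k) λ _ → sym ([]-× (first w ℕ.≤? i) (strip? v w) _))
             (sym ([]-× (i ℕ.≤? k) ((first w ℕ.≤? i) ×-dec strip? v w) _)))) ⟩
    ∑[ i ∈ upTo b ] ∑[ v ∈ box (suc b) n ] [ strip? (i ∷ v) (k ∷ w) ] g (i ∷ toList v)
      ≈⟨ ∑-box b n _ ⟨
    ∑[ v ∈ box b (suc n) ] [ strip? v (k ∷ w) ] g (toList v) ∎
    where
    T : ℕ → Carrier
    T i = [ i ℕ.≤? k ] [ first w ℕ.≤? i ]
            (∑[ v ∈ box (suc b) n ] [ strip? v w ] g (i ∷ toList v))

  ∑-box-zeros : ∀ b n (f : Vec ℕ n → Carrier) →
                ∑[ v ∈ box (suc b) n ] [ ∣ v ∣ ℕ.≟ 0 ] f v ≈ f (zeros n)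
  ∑-box-zeros b zero    f = +-identityʳ _
  ∑-box-zeros b (suc n) f = begin
    ∑[ v ∈ box (suc b) (suc n) ] [ ∣ v ∣ ℕ.≟ 0 ] f v
      ≈⟨ ∑-box (suc b) n _ ⟩
    ∑[ k ∈ upTo (suc b) ] ∑[ v ∈ box (suc (suc b)) n ] [ k ℕ.+ ∣ v ∣ ℕ.≟ 0 ] f (k ∷ v)
      ≈⟨ ∑-cong (upTo (suc b)) (λ k → trans
           (∑-cong (box (suc (suc b)) n) λ v → trans
             ([]-cong (k ℕ.+ ∣ v ∣ ℕ.≟ 0) ((k ℕ.≟ 0) ×-dec (∣ v ∣ ℕ.≟ 0))
               (λ eq → ℕ.m+n≡0⇒m≡0 k eq , ℕ.m+n≡0⇒n≡0 k eq)
               (λ { (≡.refl , eq) → eq }) λ _ → refl)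
             ([]-× (k ℕ.≟ 0) (∣ v ∣ ℕ.≟ 0) _))
           (∑-[] (k ℕ.≟ 0) (box (suc (suc b)) n) _)) ⟩
    ∑[ k ∈ upTo (suc b) ] [ k ℕ.≟ 0 ] (∑[ v ∈ box (suc (suc b)) n ] [ ∣ v ∣ ℕ.≟ 0 ] f (k ∷ v))
      ≈⟨ ∑-single {0} {suc b} (s≤s z≤n)
           (λ k → ∑[ v ∈ box (suc (suc b)) n ] [ ∣ v ∣ ℕ.≟ 0 ] f (k ∷ v)) ⟩
    ∑[ v ∈ box (suc (suc b)) n ] [ ∣ v ∣ ℕ.≟ 0 ] f (0 ∷ v)
      ≈⟨ ∑-box-zeros (suc b) n (f ∘ (0 ∷_)) ⟩
    f (zeros (suc n)) ∎

  addStrip : ℕ → ℕ → (Vec ℕ n → Carrier) → Vec ℕ n → Carrier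
  addStrip b a φ v = strips b (ofSize (∣ v ∣ ℕ.+ a) φ) v

  addStrip-cong : ∀ b a {φ ψ : Vec ℕ n → Carrier} → (∀ v → φ v ≈ ψ v) →
                  ∀ v → addStrip b a φ v ≈ addStrip b a ψ v
  addStrip-cong b a φ≈ψ v = ∑-cong (box b _) λ w →
    []-congʳ (strip? v w) λ _ → []-congʳ (∣ w ∣ ℕ.≟ ∣ v ∣ ℕ.+ a) λ _ → φ≈ψ w

  addStrips : ℕ → List ℕ → (Vec ℕ n → Carrier) → Vec ℕ n → Carrier
  addStrips b []      φ = φ
  addStrips b (a ∷ μ) φ = addStrip b a (addStrips b μ φ)

  addStrips-∷ʳ : ∀ b μ a (φ : Vec ℕ n → Carrier) v →
    addStrips b (μ ∷ʳ a) φ v ≈ addStrips b μ (addStrip b a φ) v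
  addStrips-∷ʳ b []      a φ v = refl
  addStrips-∷ʳ b (m ∷ μ) a φ v = addStrip-cong b m (addStrips-∷ʳ b μ a φ) v

  -- Adding strips is adjoint to removing them: in the sum against `number` the last strip moves
  -- from the tableau to φ. Tableaux lose their largest entry first, whereas `addStrips` adds the
  -- smallest first, hence the induction from the end of μ.
  ∑-number : ∀ b {μ} → Reverse μ → ∀ n (φ : Vec ℕ n → Carrier) →
    ∑[ v ∈ box (suc b) n ] (number (toList v) μ * φ v) ≈ addStrips (suc b) μ φ (zeros n)
  ∑-number b []             n φ = trans
    (∑-cong (box (suc b) n) λ v → trans (*-congʳ (number-[] (toList v)))
      (trans (*-comm _ _) (trans (sym ([]-* (∣ v ∣ ℕ.≟ 0) (φ v) 1#))
        ([]-congʳ (∣ v ∣ ℕ.≟ 0) λ _ → *-identityʳ _))))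
    (∑-box-zeros b n φ)
  ∑-number b (μ ∶ rev ∶ʳ m) n φ = begin
    ∑[ v ∈ V ] (number (toList v) (μ ∷ʳ m) * φ v)
      ≈⟨ ∑-cong-box (suc b) n remove ⟩
    ∑[ v ∈ V ] ∑[ u ∈ V ] (number (toList u) μ * ([ strip? u v ] [ ∣ v ∣ ℕ.≟ ∣ u ∣ ℕ.+ m ] φ v))
      ≈⟨ ∑-swap V V _ ⟩
    ∑[ u ∈ V ] ∑[ v ∈ V ] (number (toList u) μ * ([ strip? u v ] [ ∣ v ∣ ℕ.≟ ∣ u ∣ ℕ.+ m ] φ v))
      ≈⟨ ∑-cong V (λ u → ∑-*ˡ V (number (toList u) μ) _) ⟩
    ∑[ u ∈ V ] (number (toList u) μ * addStrip (suc b) m φ u)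
      ≈⟨ ∑-number b rev n (addStrip (suc b) m φ) ⟩
    addStrips (suc b) μ (addStrip (suc b) m φ) (zeros n)
      ≈⟨ addStrips-∷ʳ (suc b) μ m φ (zeros n) ⟨
    addStrips (suc b) (μ ∷ʳ m) φ (zeros n) ∎
    where
    V = box (suc b) n

    remove : ∀ v → InBox (suc b) v → number (toList v) (μ ∷ʳ m) * φ v ≈
      ∑[ u ∈ V ] (number (toList u) μ * ([ strip? u v ] [ ∣ v ∣ ℕ.≟ ∣ u ∣ ℕ.+ m ] φ v))
    remove v v∈ = begin
      number (toList v) (μ ∷ʳ m) * φ v
        ≈⟨ trans (*-congʳ (trans (number-∷ʳ (toList v) μ m) (removeStrip-box (suc b) v v∈ _)))
                 (*-comm _ _) ⟩
      φ v * (∑[ u ∈ V ] [ strip? u v ] [ ∣ v ∣ ℕ.∸ ∣ u ∣ ℕ.≟ m ] number (toList u) μ)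
        ≈⟨ ∑-*ˡ V (φ v) _ ⟨
      ∑[ u ∈ V ] (φ v * ([ strip? u v ] [ ∣ v ∣ ℕ.∸ ∣ u ∣ ℕ.≟ m ] number (toList u) μ))
        ≈⟨ ∑-cong V (λ u →
             trans (sym ([]-* (strip? u v) (φ v) _)) (trans
               -- The truncated difference |v| ∸ |u| determines |v| only if |u| ≤ |v|, which the
               -- strip condition supplies.
               ([]-congʳ (strip? u v) λ strip → trans
                 (sym ([]-* (∣ v ∣ ℕ.∸ ∣ u ∣ ℕ.≟ m) (φ v) _))
                 (trans ([]-cong (∣ v ∣ ℕ.∸ ∣ u ∣ ℕ.≟ m) (∣ v ∣ ℕ.≟ ∣ u ∣ ℕ.+ m)
                     (λ eq → ≡.trans (≡.sym (ℕ.m+[n∸m]≡n (≼⇒size≤ u v (strip⇒≼ u v strip))))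
                                     (≡.cong (∣ u ∣ ℕ.+_) eq))
                     (λ eq → ≡.trans (≡.cong (ℕ._∸ ∣ u ∣) eq) (ℕ.m+n∸m≡n ∣ u ∣ m))
                     (λ _ → *-comm _ _))
                   ([]-* (∣ v ∣ ℕ.≟ ∣ u ∣ ℕ.+ m) _ _)))
               ([]-* (strip? u v) _ _))) ⟩
      ∑[ u ∈ V ] (number (toList u) μ * ([ strip? u v ] [ ∣ v ∣ ℕ.≟ ∣ u ∣ ℕ.+ m ] φ v)) ∎

-- Partitions with at most n parts as decreasing vectors.

decreasing? : (v : Vec ℕ n) → Dec (Decreasing v)
decreasing? []      = yes tt
decreasing? (k ∷ v) = (first v ℕ.≤? k) ×-dec decreasing? v

size≡0⇒decreasing : (v : Vec ℕ n) → ∣ v ∣ ≡ 0 → Decreasing v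
size≡0⇒decreasing []          _  = tt
size≡0⇒decreasing (k ∷ [])    eq = z≤n , tt
size≡0⇒decreasing (k ∷ l ∷ v) eq =
  ℕ.≤-trans (ℕ.≤-reflexive (ℕ.m+n≡0⇒m≡0 l (ℕ.m+n≡0⇒n≡0 k eq))) z≤n ,
  size≡0⇒decreasing (l ∷ v) (ℕ.m+n≡0⇒n≡0 k eq)

size<⇒inBox : ∀ {b} (v : Vec ℕ n) → ∣ v ∣ < b → InBox b v
size<⇒inBox []      _   = tt
size<⇒inBox (k ∷ v) <b =
  ℕ.≤-<-trans (ℕ.m≤m+n k ∣ v ∣) <b ,
  size<⇒inBox v (ℕ.m<n⇒m<1+n (ℕ.≤-<-trans (ℕ.m≤n+m ∣ v ∣ k) <b))

inBox⇒∈ : ∀ {b} (v : Vec ℕ n) → InBox b v → v ∈ box b n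
inBox⇒∈ []      _           = here ≡.refl
inBox⇒∈ (k ∷ v) (k<b , v∈) =
  ∈.∈-cartesianProductWith⁺ _∷_ (∈.∈-upTo⁺ k<b) (inBox⇒∈ v v∈)

box-unique : ∀ b n → Unique (box b n)
box-unique b zero    = [] ∷ []
box-unique b (suc n) = Unique.cartesianProductWith⁺ _∷_
  (λ eq → Vec.∷-injectiveˡ eq , Vec.∷-injectiveʳ eq)
  (Unique.upTo⁺ b) (box-unique (suc b) n)

decreasing⇒linked : (v : Vec ℕ n) → Decreasing v → Linked ℕ._≥_ (toList v)
decreasing⇒linked []          _          = []
decreasing⇒linked (k ∷ [])    _          = [-]
decreasing⇒linked (k ∷ l ∷ v) (l≤k , dec) = l≤k ∷ decreasing⇒linked (l ∷ v) dec

positive? : ∀ k → Dec (k ℕ.> 0)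
positive? k = 0 ℕ.<? k

nonzero : List ℕ → List ℕ
nonzero = List.filter positive?

toList-padTo : ∀ n ks → length ks ≤ n → toList (padTo n ks) ≡ ks ⁺⁺ (n ℕ.∸ length ks)
toList-padTo zero    []       _         = ≡.refl
toList-padTo (suc n) []       _         = ≡.cong (0 ∷_) (toList-padTo n [] z≤n)
toList-padTo (suc n) (k ∷ ks) (s≤s k≤n) = ≡.cong (k ∷_) (toList-padTo n ks k≤n)

nonzero-padTo : ∀ n ks → length ks ≤ n → All (ℕ._> 0) ks → nonzero (toList (padTo n ks)) ≡ ks
nonzero-padTo zero    []           _         _         = ≡.refl
nonzero-padTo (suc n) []           _         _         = nonzero-padTo n [] z≤n []
nonzero-padTo (suc n) (suc k ∷ ks) (s≤s k≤n) (_ ∷ pos) =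
  ≡.cong (suc k ∷_) (nonzero-padTo n ks k≤n pos)

-- In a decreasing vector only zeros follow a zero, so the filter removes nothing but a tail of
-- zeros.
padTo-nonzero : (v : Vec ℕ n) → Decreasing v → padTo n (nonzero (toList v)) ≡ v
padTo-nonzero []          _         = ≡.refl
padTo-nonzero {suc n} (suc k ∷ v) (_ , dec) = ≡.cong (suc k ∷_) (padTo-nonzero v dec)
padTo-nonzero {suc n} (zero ∷ v)  (v≤0 , dec) = begin
  padTo (suc n) (nonzero (toList v)) ≡⟨ ≡.cong (padTo (suc n)) (empty v v≤0 dec) ⟩
  0 ∷ padTo n []                     ≡⟨ ≡.cong (λ ks → 0 ∷ padTo n ks) (empty v v≤0 dec) ⟨
  0 ∷ padTo n (nonzero (toList v))   ≡⟨ ≡.cong (0 ∷_) (padTo-nonzero v dec) ⟩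
  0 ∷ v                              ∎
  where
  open ≡.≡-Reasoning
  empty : ∀ {n} (v : Vec ℕ n) → first v ≤ 0 → Decreasing v → nonzero (toList v) ≡ []
  empty []         _ _          = ≡.refl
  empty (zero ∷ v) _ (v≤0 , dec) = empty v v≤0 dec

Index : ℕ → Set
Index n = ∃[ λ′ ] ℓ λ′ ≤ n

-- The order, positivity and length proofs are irrelevant. Genuine equality of indices is what makes
-- `pad` injective and so keeps `Unique` lists unique.
index-≡ : {i j : Index n} → parts (proj₁ i) ≡ parts (proj₁ j) → i ≡ j
index-≡ {i = record { parts = ks ; decreasing = d ; positive = p } , l}
        {j = record { parts = ks ; decreasing = e ; positive = q } , m} ≡.refl
  with Linked.irrelevant ℕ.≤-irrelevant d e | All.irrelevant ℕ.≤-irrelevant p q | ℕ.≤-irrelevant l m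
... | ≡.refl | ≡.refl | ≡.refl = ≡.refl

pad : Index n → Vec ℕ n
pad {n} (λ′ , _) = padTo n (parts λ′)

pad-injective : {i j : Index n} → pad i ≡ pad j → i ≡ j
pad-injective {n} {i} {j} eq = index-≡ (begin
  parts (proj₁ i)         ≡⟨ nonzero-pad i ⟨
  nonzero (toList (pad i)) ≡⟨ ≡.cong (nonzero ∘ toList) eq ⟩
  nonzero (toList (pad j)) ≡⟨ nonzero-pad j ⟩
  parts (proj₁ j)         ∎)
  where
  open ≡.≡-Reasoning
  nonzero-pad : ∀ i → nonzero (toList (pad i)) ≡ parts (proj₁ i)
  nonzero-pad (λ′ , l≤n) = nonzero-padTo n (parts λ′) l≤n (Partition.positive λ′)

unpad : Vec ℕ n → Index n
unpad v with decreasing? v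
... | yes dec = record
  { parts      = nonzero (toList v)
  ; decreasing = Linked.filter⁺ positive? (λ j≤i k≤j → ℕ.≤-trans k≤j j≤i) (decreasing⇒linked v dec)
  ; positive   = All.all-filter positive? (toList v)
  } , ℕ.≤-trans (List.length-filter positive? (toList v)) (ℕ.≤-reflexive (Vec.length-toList v))
-- An arbitrary default: `unpad` serves only to list a finite set of indices, and in `HasSum` that
-- set may be larger than necessary.
... | no _    = record { parts = [] ; decreasing = [] ; positive = [] } , z≤n

pad-unpad : (v : Vec ℕ n) → Decreasing v → pad (unpad v) ≡ v
pad-unpad v dec with decreasing? v
... | yes dec′ = padTo-nonzero v dec′
... | no ¬dec  = contradiction dec ¬dec

-- Contains the support of `number (toList v) μ` as a function of v, by `number-vanishes`, so sums
-- over different sets of vectors can be compared on it.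
Admissible : List ℕ → Vec ℕ n → Set
Admissible μ v = Decreasing v × ∣ v ∣ ≡ size μ

admissible? : ∀ μ (v : Vec ℕ n) → Dec (Admissible μ v)
admissible? μ v = decreasing? v ×-dec (∣ v ∣ ℕ.≟ size μ)

size-∷ʳ : ∀ μ m → size (μ ∷ʳ m) ≡ size μ ℕ.+ m
size-∷ʳ []      m = ℕ.+-identityʳ m
size-∷ʳ (a ∷ μ) m = ≡.trans (≡.cong (a ℕ.+_) (size-∷ʳ μ m)) (≡.sym (ℕ.+-assoc a (size μ) m))

shift-index : ∀ i k j a s → index i k j ℤ.+ + (a ℕ.+ s) ≡ index i (k ℕ.+ a) j ℤ.+ + s
shift-index i k j a s = solve 5
  (λ k i j a s → k :+ i :+ j :+ (a :+ s) := (k :+ a) :+ i :+ j :+ s)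
  ≡.refl (+ k) (ℤ.- + i) (+ j) (+ a) (+ s)
  where open ℤ.+-*-Solver

index-suc : ∀ i k j → index i k j ≡ index (suc i) (suc k) j
index-suc i k j = ≡.cong (ℤ._+ + j) (begin
  + k ℤ.- + i         ≡⟨ ℤ.[+m]-[+n]≡m⊖n k i ⟩
  k ℤ.⊖ i             ≡⟨ ℤ.[1+m]⊖[1+n]≡m⊖n k i ⟨
  suc k ℤ.⊖ suc i     ≡⟨ ℤ.[+m]-[+n]≡m⊖n (suc k) (suc i) ⟨
  + suc k ℤ.- + suc i ∎)
  where open ≡.≡-Reasoning

-- Expansion of the Toeplitz determinant and summation over partitions.

module Symbol {c ℓᴷ} (K : CommutativeRing c ℓᴷ) where
  open CommutativeRing K hiding (zero)
  open RawSemiringDefinitions (RawRing.rawSemiring rawRing) using () renaming (_×_ to _×ℕ_)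
  open SetoidReasoning setoid
  open OverRing rawRing using (atℤ; det)
  open ListSums K
  open Cancellation K
  open Determinants K
  open JacobiTrudi K
  open Coefficients K
  open Tableaux K
  open Alternating

  module _ (h : ℕ → Carrier) where

    symbolRow : Row n
    symbolRow i k j μ = atℤ h (index i k (toℕ j) ℤ.+ + size μ)

    -- This is Φ_μ of the overview.
    coefficient : List ℕ → Vec ℕ n → Carrier
    coefficient μ v = rowDetₚ symbolRow v μ

    coefficient-[] : (v : Vec ℕ n) → coefficient [] v ≈ jacobiTrudi h v
    coefficient-[] v = trans (rowDetₚ-[] symbolRow v) (Det-cong λ i j →
      reflexive (≡.cong (atℤ h) (ℤ.+-identityʳ (index (toℕ i) (Vec.lookup v i) (toℕ j)))))

    coefficient-∷ : ∀ a μ b (v : Vec ℕ n) → ∣ v ∣ ℕ.+ a < b →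
      coefficient (a ∷ μ) v ≈ above b (ofSize (∣ v ∣ ℕ.+ a) (coefficient μ)) v
    coefficient-∷ a μ b v <b = rowDetₚ-expand symbolRow
      (λ i k j a μ → reflexive (≡.cong (atℤ h) (shift-index i k (toℕ j) a (size μ)))) v a b <b μ

    alternating-≈ : {Φ Ψ : Vec ℕ n → Carrier} → (∀ v → Φ v ≈ Ψ v) →
                    Alternating Ψ → Alternating Φ
    alternating-≈ Φ≈Ψ alt = alternating
      (λ s → trans (+-cong (Φ≈Ψ _) (Φ≈Ψ _)) (antisym alt s))
      (λ s → trans (Φ≈Ψ _) (diag alt s))

    -- For `[]` this is the exchange of rows in a determinant over `K`; each further variable adds a
    -- summation handled by `above-alternating`.
    coefficient-alternating : ∀ μ → Alternating (coefficient {n} μ)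
    coefficient-alternating []      = alternating-≈ coefficient-[]
      (rowDet-alternating _ λ i k j → reflexive (≡.cong (atℤ h) (index-suc i k (toℕ j))))
    coefficient-alternating (a ∷ μ) = alternating
      (λ {v} {w} s → trans
        (+-cong (coefficient-∷ a μ _ v ℕ.≤-refl)
          -- `antisym` compares two values of one function, so `w` is expanded in the box and with
          -- the total size belonging to `v`; `Swap` preserves size.
          (trans (coefficient-∷ a μ (suc (∣ v ∣ ℕ.+ a)) w
                   (s≤s (ℕ.≤-reflexive (≡.cong (ℕ._+ a) (≡.sym (swap-size s))))))
                 (reflexive (≡.cong (λ m → above _ (ofSize (m ℕ.+ a) (coefficient μ)) w)
                                    (≡.sym (swap-size s))))))
        (antisym (above≈ v) s))
      (λ {v} s → trans (coefficient-∷ a μ _ v ℕ.≤-refl) (diag (above≈ v) s))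
      where
      above≈ : ∀ v → Alternating (above (suc (∣ v ∣ ℕ.+ a)) (ofSize (∣ v ∣ ℕ.+ a) (coefficient μ)))
      above≈ v = above-alternating _ (size-alternating _ (coefficient-alternating μ))

    coefficient≈addStrips : ∀ μ b (v : Vec ℕ n) → Decreasing v → ∣ v ∣ ℕ.+ size μ < b →
      coefficient μ v ≈ addStrips b μ (jacobiTrudi h) v
    coefficient≈addStrips []      b v _   _  = coefficient-[] v
    coefficient≈addStrips (a ∷ μ) b v dec <b = begin
      coefficient (a ∷ μ) v
        ≈⟨ coefficient-∷ a μ b v
             (ℕ.≤-<-trans (ℕ.+-monoʳ-≤ ∣ v ∣ (ℕ.m≤m+n a (size μ))) <b) ⟩
      above b (ofSize (∣ v ∣ ℕ.+ a) (coefficient μ)) v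
        ≈⟨ above≈strips b (size-alternating _ (coefficient-alternating μ)) v dec ⟩
      strips b (ofSize (∣ v ∣ ℕ.+ a) (coefficient μ)) v
        ≈⟨ ∑-cong (box b _) (λ w → []-congʳ (strip? v w) λ strip →
             []-congʳ (∣ w ∣ ℕ.≟ ∣ v ∣ ℕ.+ a) λ eq →
             coefficient≈addStrips μ b w (strip⇒decreasing v w strip)
               -- |w| + |μ| = |v| + (a + |μ|), so a single bound b serves for all steps.
               (≡.subst (_< b) (≡.sym (≡.trans (≡.cong (ℕ._+ size μ) eq)
                                               (ℕ.+-assoc ∣ v ∣ a (size μ)))) <b)) ⟩
      addStrips b (a ∷ μ) (jacobiTrudi h) v ∎

    D-generalSymbol : ∀ n μ → F.D n (generalSymbol h) μ ≈ coefficient μ (zeros n)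
    D-generalSymbol n μ = trans
      (detₚ-cong (λ i j ν → trans (generalSymbol-at h (+ toℕ j ℤ.- + toℕ i) ν)
        (reflexive (≡.cong (λ m → atℤ h (m ℤ.+ + size ν)) (entry i j)))) μ)
      (reflexive (≡.cong (_$ μ) (≡.sym (rowDetₚ≡det symbolRow (zeros n)))))
      where
      entry : ∀ (i j : Fin n) → + toℕ j ℤ.- + toℕ i ≡ index (toℕ i) (Vec.lookup (zeros n) i) (toℕ j)
      entry i j rewrite Vec.lookup-replicate i 0 = ≡.trans (ℤ.+-comm (+ toℕ j) (ℤ.- + toℕ i))
        (≡.cong (ℤ._+ + toℕ j) (≡.sym (ℤ.+-identityˡ (ℤ.- + toℕ i))))

    term : List ℕ → Vec ℕ n → Carrier
    term μ v = number (toList v) μ * jacobiTrudi h v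

    D≈∑-box : ∀ n μ → F.D n (generalSymbol h) μ ≈ ∑ (box (suc (size μ)) n) (term μ)
    D≈∑-box n μ = begin
      F.D n (generalSymbol h) μ
        ≈⟨ D-generalSymbol n μ ⟩
      coefficient μ (zeros n)
        ≈⟨ coefficient≈addStrips μ (suc (size μ)) (zeros n) (zeros-decreasing n)
             (s≤s (ℕ.≤-reflexive (≡.cong (ℕ._+ size μ) (size-zeros n)))) ⟩
      addStrips (suc (size μ)) μ (jacobiTrudi h) (zeros n)
        ≈⟨ ∑-number (size μ) (reverseView μ) n (jacobiTrudi h) ⟨
      ∑ (box (suc (size μ)) n) (term μ) ∎

    -- Adding a strip yields a decreasing vector, and sizes add up, so a tableau of content μ has
    -- decreasing shape of size |μ|.
    number-vanishes : ∀ {μ} → Reverse μ → (v : Vec ℕ n) → ¬ Admissible μ v →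
                      number (toList v) μ ≈ 0#
    number-vanishes []             v ¬adm = trans (number-[] (toList v))
      ([]-false (∣ v ∣ ℕ.≟ 0) λ eq → ¬adm (size≡0⇒decreasing v eq , eq))
    number-vanishes (μ ∶ rev ∶ʳ m) v ¬adm = begin
      number (toList v) (μ ∷ʳ m)
        ≈⟨ number-∷ʳ (toList v) μ m ⟩
      ∑[ ν ∈ removeStrip (toList v) ] [ ∣ v ∣ ℕ.∸ size ν ℕ.≟ m ] number ν μ
        ≈⟨ removeStrip-box (suc ∣ v ∣) v (size<⇒inBox v ℕ.≤-refl) _ ⟩
      ∑[ u ∈ box (suc ∣ v ∣) _ ] [ strip? u v ] [ ∣ v ∣ ℕ.∸ ∣ u ∣ ℕ.≟ m ] number (toList u) μ
        ≈⟨ ∑-0 (box (suc ∣ v ∣) _) (λ u →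
             []-zero (strip? u v) λ strip → []-zero (∣ v ∣ ℕ.∸ ∣ u ∣ ℕ.≟ m) λ eq →
             number-vanishes rev u λ (_ , ∣u∣≡) → ¬adm
               ( strip⇒decreasing u v strip
               , (≡.trans (≡.sym (ℕ.m+[n∸m]≡n (≼⇒size≤ u v (strip⇒≼ u v strip))))
                   (≡.trans (≡.cong₂ ℕ._+_ ∣u∣≡ eq) (≡.sym (size-∷ʳ μ m)))))) ⟩
      0# ∎

    ∑-admissible : ∀ μ (xs : List (Vec ℕ n)) →
      ∑ xs (term μ) ≈ ∑ (List.filter (admissible? μ) xs) (term μ)
    ∑-admissible μ xs = trans
      (∑-cong xs λ v → case v (admissible? μ v))
      (sym (∑-filter (admissible? μ) xs (term μ)))
      where
      case : ∀ v (adm? : Dec (Admissible μ v)) → term μ v ≈ [ adm? ] term μ v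
      case v (yes _)   = refl
      case v (no ¬adm) = trans (*-congʳ (number-vanishes (reverseView μ) v ¬adm)) (zeroˡ _)

    -- G may exceed the listed indices, and the box has vectors that are not decreasing. Restricted
    -- to admissible vectors, both lists are free of repetitions and have the same members, hence
    -- are permutations of each other.
    ∑-pad : ∀ n μ (G : List (Index n)) → Unique G → List.map unpad (box (suc (size μ)) n) ⊆ G →
            ∑[ i ∈ G ] term μ (pad i) ≈ ∑ (box (suc (size μ)) n) (term μ)
    ∑-pad n μ G G-unique F⊆G = begin
      ∑[ i ∈ G ] term μ (pad i)
        ≈⟨ ∑-map pad G (term μ) ⟨
      ∑ (List.map pad G) (term μ)
        ≈⟨ ∑-admissible μ (List.map pad G) ⟩
      ∑ (List.filter (admissible? μ) (List.map pad G)) (term μ)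
        ≈⟨ ∑-↭ (∼bag⇒↭ (∈.unique∧set⇒bag
             (Unique.filter⁺ (admissible? μ) (Unique.map⁺ pad-injective G-unique))
             (Unique.filter⁺ (admissible? μ) (box-unique b n))
             (mk⇔ to from))) (term μ) ⟩
      ∑ (List.filter (admissible? μ) (box b n)) (term μ)
        ≈⟨ ∑-admissible μ (box b n) ⟨
      ∑ (box b n) (term μ) ∎
      where
      b = suc (size μ)

      to : ∀ {v} → v ∈ List.filter (admissible? μ) (List.map pad G) →
           v ∈ List.filter (admissible? μ) (box b n)
      to {v} v∈ with _ , adm@(_ , size≡) ← ∈.∈-filter⁻ (admissible? μ) {xs = List.map pad G} v∈ =
        ∈.∈-filter⁺ (admissible? μ) (inBox⇒∈ v (size<⇒inBox v (s≤s (ℕ.≤-reflexive size≡)))) adm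

      from : ∀ {v} → v ∈ List.filter (admissible? μ) (box b n) →
             v ∈ List.filter (admissible? μ) (List.map pad G)
      from {v} v∈ with v∈box , adm@(dec , _) ← ∈.∈-filter⁻ (admissible? μ) {xs = box b n} v∈ =
        ∈.∈-filter⁺ (admissible? μ)
          (≡.subst (_∈ List.map pad G) (pad-unpad v dec)
            (∈.∈-map⁺ pad (F⊆G (∈.∈-map⁺ unpad v∈box)))) adm

    extendedSchur : Partition → Carrier
    extendedSchur λ′ = det {ℓ λ′} λ i j → atℤ h (index (toℕ i) (List.lookup (parts λ′) i) (toℕ j))

    term-pad : h 0 ≈ 1# → ∀ μ (i : Index n) →
               extendedSchur (proj₁ i) * (kostka (proj₁ i) μ ×ℕ 1#) ≈ term μ (pad i)
    term-pad {n} h₀ μ (λ′ , l≤n) = trans (*-comm _ _) (*-cong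
      (sym (trans (reflexive (≡.cong (λ ks → number ks μ) (toList-padTo n (parts λ′) l≤n)))
        (trans (number-⁺⁺ (reverseView μ) (parts λ′) _) (number≈kostka λ′ μ))))
      (sym (trans (jacobiTrudi-padTo h h₀ (parts λ′) (ℕ.≤⇒≤′ l≤n)) (Det≈det _))))

    sumₗ-at : ∀ {I : Set} (f : I → F.FPS) (G : List I) μ → F.sumₗ f G μ ≈ ∑[ i ∈ G ] f i μ
    sumₗ-at f []      μ = refl
    sumₗ-at f (i ∷ G) μ = +-congˡ (sumₗ-at f G μ)

    hasSum : h 0 ≈ 1# → ∀ n →
      F.HasSum {I = Index n} (λ i → extendedSchur (proj₁ i) F.• F.schur (proj₁ i))
               (F.D n (generalSymbol h))
    -- The box with bound |μ| + 1 contains every vector of size |μ|, hence every padded partition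
    -- that contributes to x^μ.
    hasSum h₀ n μ = List.map unpad (box (suc (size μ)) n) , λ G G-unique F⊆G →
      trans (sumₗ-at _ G μ) (trans (∑-cong G (term-pad h₀ μ))
        (trans (∑-pad n μ G G-unique F⊆G) (sym (D≈∑-box n μ))))

-- The normalisation h̃₀ = 1.

module Constant {c ℓ₁ ℓ₂} (R : Reals c ℓ₁ ℓ₂) where
  open Reals R hiding (_≤_) renaming (_<_ to _<ᴿ_)
  open OrderProperties R hiding (≤-trans; ≤-reflexive)

  -- If l < k or k < l, convergence with ε the distance between them contradicts f N ≈ k; tightness
  -- of the order turns the two refutations into equality.
  constant-limit : ∀ {f l k} → (∀ n → f n ≈ k) → f ⟶ l → l ≈ k
  constant-limit {f} {l} {k} f≈k f⟶l = <-tight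
    (λ l<k → let N , close = f⟶l (positive l<k) in
      irrefl refl (<-respˡ-≈ (f≈k N)
        (<-respʳ-≈ (sym (difference l k)) (proj₁ (close N ℕ.≤-refl)))))
    (λ k<l → let N , close = f⟶l (positive k<l) in
      irrefl refl (<-respʳ-≈ (trans (+-congʳ (f≈k N)) (sym (difference k l)))
        (proj₂ (close N ℕ.≤-refl))))
    where
    positive : ∀ {x y} → x <ᴿ y → 0# <ᴿ y - x
    positive {x} x<y = <-respˡ-≈ (-‿inverseʳ x) (+-monoˡ-< (- x) x<y)

  module _ (p : Parameters R) where
    open Parameters p
    open Extended R p using (h̃; e^γz; ∏[1+βz]/[1-αz])
    open Convergence R
    open OverRing rawRing using (∏[_])

    products-0 : ∀ N → ∏[ N ] (λ i → factor (α i) (β i)) 0 ≈ 1#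
    products-0 zero    = refl
    products-0 (suc N) = trans (factor-⊛-zero (α N) (β N) (∏[ N ] λ i → factor (α i) (β i)))
                               (products-0 N)

    h̃-0 : h̃ 0 ≈ 1#
    h̃-0 = trans (+-identityʳ _) (trans (*-cong e₀ ∏₀) (*-identityʳ 1#))
      where
      e₀ : e^γz 0 ≈ 1#
      -- The multiple of `1#` by 0! unfolds to `1# + 0#`, and the chosen inverse is known only
      -- through its defining equation.
      e₀ = trans (*-congʳ (sym (+-identityʳ 1#))) (proj₂ (proj₂ (inverse (0<×1 1))))

      ∏₀ : ∏[1+βz]/[1-αz] 0 ≈ 1#
      ∏₀ = constant-limit products-0
             (proj₂ (complete (coefficients-cauchy 0≤α 0≤β α-summable β-summable 0)))

theorem4 : ∀ {c ℓ₁ ℓ₂} (R : Reals c ℓ₁ ℓ₂) (p : Parameters R) (n : ℕ) → 1 ≤ n →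
    let open Extended R p in
    HasSum {I = ∃[ λ′ ] ℓ λ′ ≤ n} (λ i → S (proj₁ i) • schur (proj₁ i))
    (D n symbol)
theorem4 R p n _ = Symbol.hasSum (Reals.commutativeRing R) (Extended.h̃ R p) (Constant.h̃-0 R p) n
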